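{- For all integers $\alpha \geq 1$ and all integers $n \geq 0$, $$dp \left( 3^{2\alpha + 1}n + \frac{7 \cdot 9^\alpha + 1}{4} \right) \equiv 0 \pmod{3}.$$
   Context: A partition of a positive integer $n$ is a nonincreasing sequence of positive integers (called parts) whose sum is $n$. For $n\ge 0$, $dp(n)$ denotes the number of partitions of $n$ in which every part is either divisible by $4$ or congruent to $\pm 1 \pmod 6$ (with $dp(0)=1$). Equivalently, its generating function is $$\sum_{n=0}^{\infty} dp(n)q^n = \frac{1}{(q;q^6)_\infty (q^5;q^6)_\infty (q^4;q^4)_\infty},$$ where $(a;q)_\infty := (1-a)(1-aq)(1-aq^2)\cdots$. -}

module Defs where

open import Data.List.Base using (List; []; _∷_; _++_; map; length; filter)
open import Data.List.Membership.Propositional using (_∈_)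
open import Data.List.Membership.Propositional.Properties
  using (∈-++⁺ˡ; ∈-++⁺ʳ; ∈-++⁻; ∈-map⁺; ∈-map⁻)
open import Data.List.Relation.Binary.Disjoint.Propositional using (Disjoint)
open import Data.List.Properties using (∷-injectiveʳ)
open import Data.List.Relation.Unary.All as All using (All; []; _∷_; all?)
open import Data.List.Relation.Unary.AllPairs using ([]; _∷_)
open import Data.List.Relation.Unary.Any using (here)
open import Data.List.Relation.Unary.Linked as Linked using (Linked; []; [-]; _∷_)
open import Data.List.Relation.Unary.Linked.Properties using (Linked⇒All)
open import Data.List.Relation.Unary.Unique.Propositional using (Unique)
open import Data.List.Relation.Unary.Unique.Propositional.Properties using (++⁺; map⁺)
open import Data.Nat.Base
open import Data.Nat.Divisibility using (_∣_; _∣?_; divides; ∣m∣n⇒∣m+n; n∣m*n)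
open import Data.Nat.ListAction using (sum)
open import Data.Nat.DivMod using (_%_)
open import Data.Nat.Properties
open import Data.Nat.Tactic.RingSolver using (solve-∀)
open import Data.Product.Base using (_×_; _,_; proj₁; proj₂)
open import Data.Sum.Base using (_⊎_; inj₁; inj₂)
open import Function.Base using (flip)
open import Function.Bundles using (_⇔_; mk⇔)
open import Relation.Binary.PropositionalEquality
open import Relation.Nullary.Decidable using (Dec; yes; no; _⊎-dec_)
open import Relation.Nullary.Negation using (contradiction)

record IsPartition (n : ℕ) (xs : List ℕ) : Set where
  constructor isPartition
  field
    nonincreasing : Linked _≥_ xs
    positive      : All (0 <_) xs
    sums          : sum xs ≡ n

-- The partitions of n with at most ℓ parts, each at most k.
boundedPartitions : (ℓ k n : ℕ) → List (List ℕ)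
boundedPartitions _       _       zero    = [] ∷ []
boundedPartitions zero    _       (suc _) = []
boundedPartitions (suc _) zero    (suc _) = []
boundedPartitions (suc ℓ) (suc k) (suc n) with k ≤? n
... | yes _ = boundedPartitions (suc ℓ) k (suc n)
              ++ map (suc k ∷_) (boundedPartitions ℓ (suc k) (n ∸ k))
... | no  _ = boundedPartitions (suc ℓ) k (suc n)

-- A partition of n has at most n parts, each at most n, so the bounds are vacuous;
-- see ∈-partitions and partitions-unique.
partitions : ℕ → List (List ℕ)
partitions n = boundedPartitions n n n

-- Residues 1 and 5 are ±1 modulo 6.
Admissible : ℕ → Set
Admissible k = 4 ∣ k ⊎ (k % 6 ≡ 1 ⊎ k % 6 ≡ 5)

admissible? : ∀ k → Dec (Admissible k)
admissible? k = 4 ∣? k ⊎-dec (k % 6 ≟ 1 ⊎-dec k % 6 ≟ 5)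

dp : ℕ → ℕ
dp n = length (filter (all? admissible?) (partitions n))

private
  sound : ∀ ℓ k n {xs} → xs ∈ boundedPartitions ℓ k n → IsPartition n xs × All (_≤ k) xs
  sound _       _       zero    (here refl) = isPartition [] [] refl , []
  sound (suc ℓ) (suc k) (suc n) xs∈ with k ≤? n
  ... | no _ = let p , b = sound (suc ℓ) k (suc n) xs∈ in p , All.map m≤n⇒m≤1+n b
  ... | yes k≤n with ∈-++⁻ (boundedPartitions (suc ℓ) k (suc n)) xs∈
  ...   | inj₁ xs∈ˡ = let p , b = sound (suc ℓ) k (suc n) xs∈ˡ in p , All.map m≤n⇒m≤1+n b
  ...   | inj₂ xs∈ʳ with ∈-map⁻ (suc k ∷_) xs∈ʳ
  ...     | ys , ys∈ , refl =
    let isPartition l p s , b = sound ℓ (suc k) (n ∸ k) ys∈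
    in isPartition (cons l b) (z<s ∷ p) (cong suc (trans (cong (k +_) s) (m+[n∸m]≡n k≤n)))
       , ≤-refl ∷ b
    where
    cons : ∀ {y ys} → Linked _≥_ ys → All (_≤ y) ys → Linked _≥_ (y ∷ ys)
    cons []      []      = [-]
    cons [-]     (p ∷ _) = p ∷ [-]
    cons (q ∷ l) (p ∷ _) = p ∷ q ∷ l

  complete : ∀ ℓ k n {xs} → IsPartition n xs → length xs ≤ ℓ → All (_≤ k) xs →
             xs ∈ boundedPartitions ℓ k n
  complete _ _ zero {[]} _ _ _ = here refl
  complete _ _ zero {suc _ ∷ _} (isPartition _ _ ()) _ _
  complete _ _ zero {zero ∷ _} (isPartition _ (() ∷ _) _) _ _
  complete _ _ (suc _) {[]} (isPartition _ _ ()) _ _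
  complete zero _ (suc _) {_ ∷ _} _ () _
  complete (suc _) zero (suc _) {_ ∷ _} (isPartition _ (z<s ∷ _) _) _ (() ∷ _)
  complete (suc ℓ) (suc k) (suc n) {x ∷ xs} p@(isPartition l (_ ∷ pos) s) len@(s≤s len′) (x≤1+k ∷ _)
    with k ≤? n | m≤n⇒m<n∨m≡n x≤1+k
  ... | yes _ | inj₁ x<1+k =
    ∈-++⁺ˡ (complete (suc ℓ) k (suc n) p len (Linked⇒All (flip ≤-trans) (s≤s⁻¹ x<1+k) l))
  ... | yes _ | inj₂ refl =
    ∈-++⁺ʳ (boundedPartitions (suc ℓ) k (suc n)) (∈-map⁺ (suc k ∷_)
      (complete ℓ (suc k) (n ∸ k)
        (isPartition (Linked.tail l) pos
          (trans (sym (m+n∸m≡n k (sum xs))) (cong (_∸ k) (suc-injective s))))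
        len′ (All.tail (Linked⇒All (flip ≤-trans) ≤-refl l))))
  ... | no k≰n | _ =
    complete (suc ℓ) k (suc n) p len (Linked⇒All (flip ≤-trans) x≤k l)
    where
    x≤k : x ≤ k
    x≤k = ≤-trans (≤-trans (m≤m+n x (sum xs)) (≤-reflexive s)) (≰⇒> k≰n)

  unique : ∀ ℓ k n → Unique (boundedPartitions ℓ k n)
  unique _       _       zero    = [] ∷ []
  unique zero    _       (suc _) = []
  unique (suc _) zero    (suc _) = []
  unique (suc ℓ) (suc k) (suc n) with k ≤? n
  ... | no  _ = unique (suc ℓ) k (suc n)
  ... | yes _ = ++⁺ (unique (suc ℓ) k (suc n))
                    (map⁺ ∷-injectiveʳ (unique ℓ (suc k) (n ∸ k))) disjoint
    where
    disjoint : Disjoint (boundedPartitions (suc ℓ) k (suc n))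
                        (map (suc k ∷_) (boundedPartitions ℓ (suc k) (n ∸ k)))
    disjoint (xs∈ˡ , xs∈ʳ)
      with _ , _ , refl ← ∈-map⁻ (suc k ∷_) xs∈ʳ
      with 1+k≤k ∷ _ ← proj₂ (sound (suc ℓ) k (suc n) xs∈ˡ) = contradiction 1+k≤k 1+n≰n

  length≤sum : ∀ {xs} → All (0 <_) xs → length xs ≤ sum xs
  length≤sum []          = z≤n
  length≤sum (0<x ∷ pos) = +-mono-≤ 0<x (length≤sum pos)

  parts≤sum : ∀ xs → All (_≤ sum xs) xs
  parts≤sum []       = []
  parts≤sum (x ∷ xs) = m≤m+n x (sum xs)
                     ∷ All.map (λ y≤ → ≤-trans y≤ (m≤n+m (sum xs) x)) (parts≤sum xs)

∈-partitions : ∀ {n xs} → xs ∈ partitions n ⇔ IsPartition n xs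
∈-partitions {n} {xs} = mk⇔ (λ xs∈ → proj₁ (sound n n n xs∈)) from
  where
  from : ∀ {n} → IsPartition n xs → xs ∈ partitions n
  from p@(isPartition _ pos refl) = complete _ _ _ p (length≤sum pos) (parts≤sum xs)

partitions-unique : ∀ n → Unique (partitions n)
partitions-unique n = unique n n n

-- The division in (7 * 9 ^ α + 1) / 4 is exact.
4∣7*9^α+1 : ∀ α → 4 ∣ 7 * 9 ^ α + 1
4∣7*9^α+1 zero    = divides 2 refl
4∣7*9^α+1 (suc α) = subst (4 ∣_) (step (9 ^ α))
  (∣m∣n⇒∣m+n (4∣7*9^α+1 α) (n∣m*n (14 * 9 ^ α)))
  where
  step : ∀ m → 7 * m + 1 + 14 * m * 4 ≡ 7 * (9 * m) + 1
  step = solve-∀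

{-# OPTIONS --safe #-}
-- Let D be the generating function of dp, reduced modulo 3, and put θ(a,b) = Σ_k a^{k(k+1)/2} b^{k(k-1)/2}
-- (k over ℤ), φ(q) = θ(q,q), ψ(q) = θ(q,q³), A(q) = θ(q,q²), E₄ = (q⁴;q⁴)_∞.  Modulo 3 every series satisfies
-- f(q)³ = f(q³), so series in q³ are exactly the cubes.  Jacobi's triple product gives D(q) E₄³ = ψ(-q)².
-- Since ψ(y) = A(y)³ + y ψ(y)⁹, comparing the exponents ≡ 1 (mod 3) gives D₁ E₄ = A(-q) ψ(-q)³ for
-- D₁ = Σ dp(3n+1) qⁿ, and the product identities A(y) ψ(-y) = E₄ φ(-y)³ (modulo 3) and
-- φ(-y) ψ(y) = ψ(-y) φ(-y²) turn this into D₁ = ψ(q)² φ(-q²)³.  The exponents ≡ 2 (mod 3) of D₁ form the series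
-- W = Σ dp(9n+7) qⁿ = ψ(q)⁶ φ(-q²), in which φ(-q²) = φ(-q²)⁹ - q² C³ has no exponents ≡ 1 (mod 3).  Hence
-- dp(27n+16) ≡ 0, while the exponents ≡ 0 (mod 3) of W give dp(27n+7) ≡ dp(3n+1); as
-- (7·9^{α+1}+1)/4 = 9 (7·9^α+1)/4 - 2, the congruence propagates from α to α + 1.
module Submission where

open import Defs
open import Algebra.Bundles using (CommutativeMonoid; CommutativeRing; CommutativeSemiring)
import Algebra.Properties.CommutativeSemigroup as CommutativeSemigroupProperties
import Algebra.Properties.CommutativeSemiring.Exp as Exp
import Algebra.Properties.Ring as RingProperties
import Algebra.Solver.Ring.NaturalCoefficients.Default as SemiringSolver
open import Algebra.Structures using (IsCommutativeMonoid; IsCommutativeRing)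
open import Data.Bool.Base using (Bool; true; false; if_then_else_; _∨_)
open import Data.List.Base using ([]; _∷_; map; length; filter)
open import Data.List.Properties using (filter-++; length-++)
open import Data.List.Relation.Unary.All using (all?)
open import Data.Nat.Base as ℕ using (ℕ; zero; suc; z≤n; s≤s)
open import Data.Nat.DivMod using (_%_; %-distribˡ-+; %-distribˡ-*; [m+kn]%n≡m%n; m*n%n≡0; m*n/n≡m)
open import Data.Nat.Divisibility using (_∣_; m%n≡0⇒n∣m)
import Data.Nat.Properties as ℕ
open import Data.Nat.Tactic.RingSolver using (solve-∀)
open import Data.Product.Base using (Σ-syntax; _,_)
open import Data.Sum.Base using (inj₁; inj₂)
open import Function.Base using (_∘_)
open import Level using (_⊔_)
open import Relation.Binary.PropositionalEquality as ≡ using (_≡_)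
import Relation.Binary.Reasoning.Setoid as SetoidReasoning
open import Relation.Nullary.Decidable using (yes; no; does)
open import Relation.Nullary.Negation using (contradiction)

-- Folds over initial segments and formal power series

-- No series is ever inverted. The generating function enters only through the equation "D times its
-- denominator is 1", and every other division is a multiplication of both sides by a series with
-- constant term 1, undone by `unit-cancel`. The collapse modulo 3 has one source. Odd numbers fill
-- the classes 1, 3, 5 modulo 6, and the product over class 3 is modulo 3 the cube of the product
-- over all odd numbers; so the classes 1 and 5 kept by D differ from (q;q²)_∞ only by a cube. Cubes
-- are transparent to the selection of exponents in a class modulo 3: such a factor leaves the
-- selection as its own cube root. Multiplying D by E₄³ therefore costs nothing, and dissecting D
-- reduces to dissecting ψ². The same transparency explains the self-similarity: the part of φ(-q²)
-- in class 0 is the cube of φ(-q²)³, and φ(-q²)³ is exactly the factor by which D₁ differs from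
-- ψ(q)². Reading cubes as series in q³ takes two facts about the coefficients: 3 = 0, which makes
-- cubing additive, and x³ = x, which keeps each coefficient fixed.

module RangeFold {c ℓ} (M : CommutativeMonoid c ℓ) where
  open CommutativeMonoid M
  open CommutativeSemigroupProperties commutativeSemigroup using (interchange)
  open SetoidReasoning setoid

  fold : (ℕ → Carrier) → ℕ → Carrier
  fold u zero    = ε
  fold u (suc n) = u 0 ∙ fold (u ∘ suc) n

  -- The relation is abstract so that one induction serves both exact equality (`fold-cong`) and
  -- equality up to a given degree (`fold-cong[]`).
  fold-rel : ∀ {r} (_~_ : Carrier → Carrier → Set r) → ε ~ ε →
             (∀ {x y z w} → x ~ y → z ~ w → (x ∙ z) ~ (y ∙ w)) →
             ∀ {u v} → (∀ i → u i ~ v i) → ∀ n → fold u n ~ fold v n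
  fold-rel _~_ ε~ε ∙-~ u~v zero    = ε~ε
  fold-rel _~_ ε~ε ∙-~ u~v (suc n) = ∙-~ (u~v 0) (fold-rel _~_ ε~ε ∙-~ (u~v ∘ suc) n)

  fold-cong : ∀ {u v} → (∀ i → u i ≈ v i) → ∀ n → fold u n ≈ fold v n
  fold-cong = fold-rel _≈_ refl ∙-cong

  fold-snoc : ∀ u n → fold u (suc n) ≈ fold u n ∙ u n
  fold-snoc u zero    = trans (identityʳ (u 0)) (sym (identityˡ (u 0)))
  fold-snoc u (suc n) = trans (∙-congˡ (fold-snoc (u ∘ suc) n)) (sym (assoc _ _ _))

  fold-∙ : ∀ u v n → fold (λ i → u i ∙ v i) n ≈ fold u n ∙ fold v n
  fold-∙ u v zero    = sym (identityˡ ε)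
  fold-∙ u v (suc n) = trans (∙-congˡ (fold-∙ (u ∘ suc) (v ∘ suc) n)) (interchange _ _ _ _)

  fold-ε : ∀ n → fold (λ _ → ε) n ≈ ε
  fold-ε zero    = refl
  fold-ε (suc n) = trans (identityˡ _) (fold-ε n)

  fold-+ : ∀ u m n → fold u (m ℕ.+ n) ≈ fold u m ∙ fold (λ j → u (j ℕ.+ m)) n
  fold-+ u zero    n = sym (trans (identityˡ _)
    (fold-cong (λ j → reflexive (≡.cong u (ℕ.+-identityʳ j))) n))
  fold-+ u (suc m) n = trans
    (∙-congˡ (trans (fold-+ (u ∘ suc) m n)
      (∙-congˡ (fold-cong (λ j → reflexive (≡.cong u (≡.sym (ℕ.+-suc j m)))) n))))
    (sym (assoc _ _ _))

  -- Division of the index by `k` with remainder `j`; every splitting of a product or a series by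
  -- residue classes rests on this.
  fold-blocks : ∀ u k n → fold (λ i → fold (λ j → u (j ℕ.+ i ℕ.* k)) k) n ≈ fold u (n ℕ.* k)
  fold-blocks u k zero    = refl
  fold-blocks u k (suc n) = begin
    fold (λ j → u (j ℕ.+ 0)) k ∙ fold (λ i → fold (λ j → u (j ℕ.+ (k ℕ.+ i ℕ.* k))) k) n
      ≈⟨ ∙-cong (fold-cong (λ j → reflexive (≡.cong u (ℕ.+-identityʳ j))) k)
                (fold-cong (λ i → fold-cong (λ j → reflexive (≡.cong u (shift j i))) k) n) ⟩
    fold u k ∙ fold (λ i → fold (λ j → u (j ℕ.+ i ℕ.* k ℕ.+ k)) k) n
      ≈⟨ ∙-congˡ (fold-blocks (λ j → u (j ℕ.+ k)) k n) ⟩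
    fold u k ∙ fold (λ j → u (j ℕ.+ k)) (n ℕ.* k)
      ≈⟨ fold-+ u k (n ℕ.* k) ⟨
    fold u (k ℕ.+ n ℕ.* k) ∎
    where
    shift : ∀ j i → j ℕ.+ (k ℕ.+ i ℕ.* k) ≡ j ℕ.+ i ℕ.* k ℕ.+ k
    shift j i = ≡.trans (≡.cong (j ℕ.+_) (ℕ.+-comm k (i ℕ.* k))) (≡.sym (ℕ.+-assoc j _ k))

module PowerSeries {c ℓ} (R : CommutativeRing c ℓ) where
  private
    module K = CommutativeRing R
    open SemiringSolver K.commutativeSemiring using (solve; _:=_; _:+_; _:*_)

  Series : Set c
  Series = ℕ → K.Carrier

  infix 4 _≈_ _≈[_]_

  -- A record instead of a bare function type, so that `f` and `g` can be inferred from an equation;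
  -- unfolded to coefficients they would be lost to unification.
  record _≈_ (f g : Series) : Set ℓ where
    constructor coeffwise
    field coeff : ∀ n → f n K.≈ g n
  open _≈_ public

  -- Congruence modulo X^N, the notion of approximation behind all limits here.
  record _≈[_]_ (f : Series) (N : ℕ) (g : Series) : Set ℓ where
    constructor coeffwise[]
    field coeff[] : ∀ {n} → n ℕ.< N → f n K.≈ g n
  open _≈[_]_ public

  infixl 6 _+_
  infixl 7 _*_
  infix  8 -_

  _+_ : Series → Series → Series
  (f + g) n = f n K.+ g n

  -_ : Series → Series
  (- f) n = K.- f n

  0# : Series
  0# _ = K.0#

  1# : Series
  1# zero    = K.1#
  1# (suc _) = K.0#

  X : Series
  X zero    = K.0#
  X (suc n) = 1# n

  -- The Cauchy product in the form f g = f₀ g + X (f₁ g), where f = f₀ + X f₁. The recursion shifts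
  -- only the left factor and needs no finite sums.
  _*_ : Series → Series → Series
  (f * g) zero    = f 0 K.* g 0
  (f * g) (suc n) = f 0 K.* g (suc n) K.+ ((f ∘ suc) * g) n

  private
    *-cong≤ : ∀ {f f′ g g′} n → (∀ {i} → i ℕ.≤ n → f i K.≈ f′ i) →
              (∀ {i} → i ℕ.≤ n → g i K.≈ g′ i) → (f * g) n K.≈ (f′ * g′) n
    *-cong≤ zero    p q = K.*-cong (p z≤n) (q z≤n)
    *-cong≤ (suc n) p q = K.+-cong (K.*-cong (p z≤n) (q ℕ.≤-refl))
      (*-cong≤ n (p ∘ s≤s) (q ∘ ℕ.m≤n⇒m≤1+n))

    -- Peels the convolution at its other end. Commutativity follows by playing this against the
    -- defining clause.
    *-snoc : ∀ f g n → (f * g) (suc n) K.≈ (f * (g ∘ suc)) n K.+ f (suc n) K.* g 0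
    *-snoc f g zero    = K.refl
    *-snoc f g (suc n) = K.trans (K.+-congˡ (*-snoc (f ∘ suc) g n)) (K.sym (K.+-assoc _ _ _))

    *-comm′ : ∀ f g n → (f * g) n K.≈ (g * f) n
    *-comm′ f g zero    = K.*-comm (f 0) (g 0)
    *-comm′ f g (suc n) = K.trans (K.+-comm _ _) (K.trans
      (K.+-cong (*-comm′ (f ∘ suc) g n) (K.*-comm (f 0) (g (suc n))))
      (K.sym (*-snoc g f n)))

    *-distribʳ′ : ∀ h f g n → ((f + g) * h) n K.≈ (f * h) n K.+ (g * h) n
    *-distribʳ′ h f g zero    = K.distribʳ (h 0) (f 0) (g 0)
    *-distribʳ′ h f g (suc n) = K.trans
      (K.+-congˡ (*-distribʳ′ h (f ∘ suc) (g ∘ suc) n))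
      (solve 5 (λ a b x p q → (a :+ b) :* x :+ (p :+ q) := a :* x :+ p :+ (b :* x :+ q))
        K.refl (f 0) (g 0) (h (suc n)) _ _)

    *-scale : ∀ a g h n → ((λ i → a K.* g i) * h) n K.≈ a K.* (g * h) n
    *-scale a g h zero    = K.*-assoc a (g 0) (h 0)
    *-scale a g h (suc n) = K.trans (K.+-congˡ (*-scale a (g ∘ suc) h n))
      (solve 4 (λ a b x p → a :* b :* x :+ a :* p := a :* (b :* x :+ p))
        K.refl a (g 0) (h (suc n)) _)

    *-assoc′ : ∀ f g h n → ((f * g) * h) n K.≈ (f * (g * h)) n
    *-assoc′ f g h zero    = K.*-assoc (f 0) (g 0) (h 0)
    *-assoc′ f g h (suc n) = K.trans
      (K.+-congˡ (K.trans (*-distribʳ′ h (λ i → f 0 K.* g (suc i)) ((f ∘ suc) * g) n)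
        (K.+-cong (*-scale (f 0) (g ∘ suc) h n) (*-assoc′ (f ∘ suc) g h n))))
      (solve 5 (λ a b x p q → a :* b :* x :+ (a :* p :+ q) := a :* (b :* x :+ p) :+ q)
        K.refl (f 0) (g 0) (h (suc n)) _ _)

    *-zeroˡ′ : ∀ g n → (0# * g) n K.≈ K.0#
    *-zeroˡ′ g zero    = K.zeroˡ (g 0)
    *-zeroˡ′ g (suc n) = K.trans (K.+-cong (K.zeroˡ _) (*-zeroˡ′ g n)) (K.+-identityˡ K.0#)

    *-identityˡ′ : ∀ g n → (1# * g) n K.≈ g n
    *-identityˡ′ g zero    = K.*-identityˡ (g 0)
    *-identityˡ′ g (suc n) = K.trans (K.+-cong (K.*-identityˡ _) (*-zeroˡ′ g n)) (K.+-identityʳ _)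

  isCommutativeRing : IsCommutativeRing _≈_ _+_ _*_ -_ 0# 1#
  isCommutativeRing = record
    { isRing = record
      { +-isAbelianGroup = record
        { isGroup = record
          { isMonoid = record
            { isSemigroup = record
              { isMagma = record
                { isEquivalence = record
                  { refl  = coeffwise λ _ → K.refl
                  ; sym   = λ p → coeffwise λ n → K.sym (coeff p n)
                  ; trans = λ p q → coeffwise λ n → K.trans (coeff p n) (coeff q n)
                  }
                ; ∙-cong = λ p q → coeffwise λ n → K.+-cong (coeff p n) (coeff q n)
                }
              ; assoc = λ f g h → coeffwise λ n → K.+-assoc (f n) (g n) (h n)
              }
            ; identity = (λ f → coeffwise λ n → K.+-identityˡ (f n))
                       , (λ f → coeffwise λ n → K.+-identityʳ (f n))
            }
          ; inverse = (λ f → coeffwise λ n → K.-‿inverseˡ (f n))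
                    , (λ f → coeffwise λ n → K.-‿inverseʳ (f n))
          ; ⁻¹-cong = λ p → coeffwise λ n → K.-‿cong (coeff p n)
          }
        ; comm = λ f g → coeffwise λ n → K.+-comm (f n) (g n)
        }
      ; *-cong     = λ p q → coeffwise λ n → *-cong≤ n (λ {i} _ → coeff p i) (λ {i} _ → coeff q i)
      ; *-assoc    = λ f g h → coeffwise (*-assoc′ f g h)
      ; *-identity = (λ f → coeffwise (*-identityˡ′ f))
                   , (λ f → coeffwise λ n → K.trans (*-comm′ f 1# n) (*-identityˡ′ f n))
      ; distrib    = (λ f g h → coeffwise λ n → K.trans (*-comm′ f (g + h) n)
                       (K.trans (*-distribʳ′ f g h n) (K.+-cong (*-comm′ g f n) (*-comm′ h f n))))
                   , (λ h f g → coeffwise (*-distribʳ′ h f g))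
      }
    ; *-comm = λ f g → coeffwise (*-comm′ f g)
    }

  seriesRing : CommutativeRing c ℓ
  seriesRing = record { isCommutativeRing = isCommutativeRing }

  open CommutativeRing seriesRing public
    hiding (Carrier; _≈_; _+_; _*_; -_; 0#; 1#; isCommutativeRing; zero)
  open Exp commutativeSemiring public
  open RingProperties ring public using (-‿distribˡ-*; -‿distribʳ-*; -‿involutive; -0#≈0#)

  refl[] : ∀ {N f} → f ≈[ N ] f
  refl[] = coeffwise[] λ _ → K.refl

  sym[] : ∀ {N f g} → f ≈[ N ] g → g ≈[ N ] f
  sym[] p = coeffwise[] λ n<N → K.sym (coeff[] p n<N)

  trans[] : ∀ {N f g h} → f ≈[ N ] g → g ≈[ N ] h → f ≈[ N ] h
  trans[] p q = coeffwise[] λ n<N → K.trans (coeff[] p n<N) (coeff[] q n<N)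

  ≈⇒≈[] : ∀ {N f g} → f ≈ g → f ≈[ N ] g
  ≈⇒≈[] p = coeffwise[] λ {n} _ → coeff p n

  ≈[]⇒≈ : ∀ {f g} → (∀ N → f ≈[ N ] g) → f ≈ g
  ≈[]⇒≈ p = coeffwise λ n → coeff[] (p (suc n)) ℕ.≤-refl

  ≈[]-weaken : ∀ {M N f g} → M ℕ.≤ N → f ≈[ N ] g → f ≈[ M ] g
  ≈[]-weaken M≤N p = coeffwise[] λ n<M → coeff[] p (ℕ.≤-trans n<M M≤N)

  +-cong[] : ∀ {N f g h k} → f ≈[ N ] g → h ≈[ N ] k → f + h ≈[ N ] g + k
  +-cong[] p q = coeffwise[] λ n<N → K.+-cong (coeff[] p n<N) (coeff[] q n<N)

  *-cong[] : ∀ {N f g h k} → f ≈[ N ] g → h ≈[ N ] k → f * h ≈[ N ] g * k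
  *-cong[] p q = coeffwise[] λ {n} n<N →
    *-cong≤ n (λ i≤n → coeff[] p (ℕ.≤-<-trans i≤n n<N)) (λ i≤n → coeff[] q (ℕ.≤-<-trans i≤n n<N))

  *-zero[] : ∀ {N} f {g} → g ≈[ N ] 0# → f * g ≈[ N ] 0#
  *-zero[] f p = trans[] (*-cong[] refl[] p) (≈⇒≈[] (zeroʳ f))

  zero[]-* : ∀ {N f} g → f ≈[ N ] 0# → f * g ≈[ N ] 0#
  zero[]-* g p = trans[] (*-cong[] p refl[]) (≈⇒≈[] (zeroˡ g))

  +-zero[] : ∀ {N f g} → f ≈[ N ] 0# → g ≈[ N ] 0# → f + g ≈[ N ] 0#
  +-zero[] p q = trans[] (+-cong[] p q) (≈⇒≈[] (+-identityˡ 0#))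

  1+-zero[] : ∀ {N f} → f ≈[ N ] 0# → 1# + f ≈[ N ] 1#
  1+-zero[] p = trans[] (+-cong[] refl[] p) (≈⇒≈[] (+-identityʳ 1#))

  *-one[] : ∀ {N f g} → f ≈[ N ] 1# → g ≈[ N ] 1# → f * g ≈[ N ] 1#
  *-one[] p q = trans[] (*-cong[] p q) (≈⇒≈[] (*-identityˡ 1#))

  NoConstant : Series → Set ℓ
  NoConstant f = f ≈[ 1 ] 0#

  -- The gain of one degree makes powers of `f` tend to zero and drives the cancellation of units.
  noConstant-* : ∀ {N f g} → NoConstant f → g ≈[ N ] 0# → f * g ≈[ suc N ] 0#
  noConstant-* {N} {f} {g} f₀ p = coeffwise[] λ
    { {zero} _ → K.trans (K.*-congʳ (coeff[] f₀ ℕ.z<s)) (K.zeroˡ _)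
    ; {suc n} (s≤s n<N) → K.trans
        (K.+-cong (K.trans (K.*-congʳ (coeff[] f₀ ℕ.z<s)) (K.zeroˡ _))
                  (coeff[] (*-zero[] (f ∘ suc) p) n<N))
        (K.+-identityˡ K.0#) }

  noConstant-^ : ∀ {f} → NoConstant f → ∀ n → f ^ n ≈[ n ] 0#
  noConstant-^ f₀ zero    = coeffwise[] λ ()
  noConstant-^ f₀ (suc n) = noConstant-* f₀ (noConstant-^ f₀ n)

  noConstant-X : NoConstant X
  noConstant-X = coeffwise[] λ { (s≤s z≤n) → K.refl }

  noConstant-neg : ∀ {f} → NoConstant f → NoConstant (- f)
  noConstant-neg f₀ = coeffwise[] λ n<1 → K.trans (K.-‿cong (coeff[] f₀ n<1))
    (RingProperties.-0#≈0# K.ring)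

  X*-suc : ∀ f n → (X * f) (suc n) K.≈ f n
  X*-suc f n = K.trans (K.+-cong (K.zeroˡ _) (coeff (*-identityˡ f) n)) (K.+-identityˡ _)

  X^-* : ∀ k f n → (X ^ k * f) (k ℕ.+ n) K.≈ f n
  X^-* zero    f n = coeff (*-identityˡ f) n
  X^-* (suc k) f n = K.trans (coeff (*-assoc X (X ^ k) f) (suc k ℕ.+ n))
    (K.trans (X*-suc (X ^ k * f) (k ℕ.+ n)) (X^-* k f n))

  Unit : Series → Set ℓ
  Unit f = f ≈[ 1 ] 1#

  -- The difference `d` of `g` and `h` is killed by `f`, hence satisfies d = (1 - f) d. As 1 - f has
  -- no constant term, each use of this equation raises the order to which `d` vanishes.
  unit-cancel : ∀ {f g h} → Unit f → f * g ≈ f * h → g ≈ h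
  unit-cancel {f} {g} {h} f₀ fg≈fh = begin
    g             ≈⟨ +-identityʳ g ⟨
    g + 0#        ≈⟨ +-congˡ (-‿inverseˡ h) ⟨
    g + (- h + h) ≈⟨ +-assoc g (- h) h ⟨
    d + h         ≈⟨ +-congʳ (≈[]⇒≈ d≈0) ⟩
    0# + h        ≈⟨ +-identityˡ h ⟩
    h             ∎
    where
    open SetoidReasoning setoid
    d t : Series
    d = g + - h
    t = 1# + - f
    t₀ : NoConstant t
    t₀ = trans[] (+-cong[] (sym[] f₀) refl[]) (≈⇒≈[] (-‿inverseʳ f))
    fd≈0 : f * d ≈ 0#
    fd≈0 = begin
      f * (g + - h)     ≈⟨ distribˡ f g (- h) ⟩
      f * g + f * - h   ≈⟨ +-cong fg≈fh (sym (-‿distribʳ-* f h)) ⟩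
      f * h + - (f * h) ≈⟨ -‿inverseʳ (f * h) ⟩
      0#                ∎
    d≈td : d ≈ t * d
    d≈td = begin
      d                ≈⟨ *-identityˡ d ⟨
      1# * d           ≈⟨ +-identityʳ (1# * d) ⟨
      1# * d + 0#      ≈⟨ +-congˡ (trans (-‿cong fd≈0) -0#≈0#) ⟨
      1# * d + - (f * d) ≈⟨ +-congˡ (-‿distribˡ-* f d) ⟩
      1# * d + - f * d ≈⟨ distribʳ d 1# (- f) ⟨
      t * d            ∎
    d≈0 : ∀ N → d ≈[ N ] 0#
    d≈0 zero    = coeffwise[] λ ()
    d≈0 (suc N) = trans[] (≈⇒≈[] d≈td) (noConstant-* t₀ (d≈0 N))

  -- A common treatment of infinite sums and infinite products, instantiated below as `Σ` and `Π`.
  module InfiniteFold {_∙_ ε} (isCommutativeMonoid : IsCommutativeMonoid _≈_ _∙_ ε)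
    (∙-cong[] : ∀ {N f g h k} → f ≈[ N ] g → h ≈[ N ] k → (f ∙ h) ≈[ N ] (g ∙ k)) where

    private
      module M = IsCommutativeMonoid isCommutativeMonoid

      commutativeMonoid : CommutativeMonoid c ℓ
      commutativeMonoid = record { isCommutativeMonoid = isCommutativeMonoid }

    open RangeFold commutativeMonoid public

    -- A fixed rate instead of an existential one: coefficient n is settled by the first n + 1
    -- terms, which is what the diagonal definition of `fold∞` reads off.
    Convergent : (ℕ → Series) → Set ℓ
    Convergent u = ∀ i → u i ≈[ i ] ε

    fold∞ : (ℕ → Series) → Series
    fold∞ u n = fold u (suc n) n

    fold-cong[] : ∀ {N u v} → (∀ i → u i ≈[ N ] v i) → ∀ n → fold u n ≈[ N ] fold v n
    fold-cong[] {N} = fold-rel (_≈[ N ]_) refl[] ∙-cong[]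

    fold-one[] : ∀ {N u} → (∀ i → u i ≈[ N ] ε) → ∀ n → fold u n ≈[ N ] ε
    fold-one[] p n = trans[] (fold-cong[] p n) (≈⇒≈[] (fold-ε n))

    fold-stable : ∀ {u} → Convergent u → ∀ {M N} → N ℕ.≤ M → fold u M ≈[ N ] fold u N
    fold-stable {u} con {M} {N} N≤M = trans[]
      (≈⇒≈[] (M.trans (M.reflexive (≡.cong (fold u) (≡.sym (ℕ.m+[n∸m]≡n N≤M)))) (fold-+ u N (M ℕ.∸ N))))
      (trans[] (∙-cong[] refl[] (fold-one[] (λ j → ≈[]-weaken (ℕ.m≤n+m N j) (con (j ℕ.+ N))) (M ℕ.∸ N)))
               (≈⇒≈[] (M.identityʳ _)))

    fold∞-truncate : ∀ {u} → Convergent u → ∀ {M N} → N ℕ.≤ M → fold∞ u ≈[ N ] fold u M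
    fold∞-truncate con N≤M = coeffwise[] λ n<N →
      K.sym (coeff[] (fold-stable con (ℕ.≤-trans n<N N≤M)) ℕ.≤-refl)

    fold∞-cong : ∀ {u v} → (∀ i → u i ≈ v i) → fold∞ u ≈ fold∞ v
    fold∞-cong p = coeffwise λ n → coeff (fold-cong p (suc n)) n

    fold∞-suc : ∀ {u} → Convergent u → fold∞ u ≈ (u 0 ∙ fold∞ (u ∘ suc))
    fold∞-suc {u} con = ≈[]⇒≈ λ N → trans[] (fold∞-truncate con (ℕ.n≤1+n N))
      (∙-cong[] refl[] (sym[] (fold∞-truncate (λ i → ≈[]-weaken (ℕ.n≤1+n i) (con (suc i))) ℕ.≤-refl)))

    fold∞-∙ : ∀ {u v} → Convergent u → Convergent v →
              fold∞ (λ i → u i ∙ v i) ≈ (fold∞ u ∙ fold∞ v)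
    fold∞-∙ {u} {v} cu cv = coeffwise λ n → K.trans (coeff (fold-∙ u v (suc n)) n)
      (K.sym (coeff[] (∙-cong[] (fold∞-truncate cu ℕ.≤-refl) (fold∞-truncate cv ℕ.≤-refl)) ℕ.≤-refl))

    -- Respecting truncation is continuity of `h`. The instances are multiplication by a fixed
    -- series and, in characteristic 3, the third and ninth powers.
    fold∞-hom : (h : Series → Series) → (∀ {N f g} → f ≈[ N ] g → h f ≈[ N ] h g) → h ε ≈ ε →
                (∀ f g → h (f ∙ g) ≈ (h f ∙ h g)) →
                ∀ {u} → Convergent u → h (fold∞ u) ≈ fold∞ (h ∘ u)
    fold∞-hom h h-cong h-ε h-∙ {u} con = coeffwise λ n → K.trans
      (coeff[] (h-cong (fold∞-truncate con ℕ.≤-refl)) ℕ.≤-refl) (coeff (h-fold u (suc n)) n)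
      where
      h-fold : ∀ u n → h (fold u n) ≈ fold (h ∘ u) n
      h-fold u zero    = h-ε
      h-fold u (suc n) = M.trans (h-∙ _ _) (M.∙-congˡ (h-fold (u ∘ suc) n))

    fold∞-blocks : ∀ k .{{_ : ℕ.NonZero k}} {u} → Convergent u →
                   fold∞ u ≈ fold∞ (λ i → fold (λ j → u (j ℕ.+ i ℕ.* k)) k)
    fold∞-blocks k {u} con = coeffwise λ n → K.trans
      (K.sym (coeff[] (fold-stable con (ℕ.m≤m*n (suc n) k)) ℕ.≤-refl))
      (K.sym (coeff (fold-blocks u k (suc n)) n))

  module Σ = InfiniteFold +-isCommutativeMonoid +-cong[]
  module Π = InfiniteFold *-isCommutativeMonoid *-cong[]

-- Jacobi's triple product

triangular : ℕ → ℕ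
triangular zero    = 0
triangular (suc k) = suc k ℕ.+ triangular k

-- The finite form of the triple product is subtraction-free, so its identities are within reach of
-- the semiring solver. Minus signs first arise when passing to the limit.
module GaussianBinomial {c ℓ} (S : CommutativeSemiring c ℓ) where
  open CommutativeSemiring S hiding (zero)
  open Exp S
  open SemiringSolver S using (solve; _:=_; _:+_; _:*_; con)
  open SetoidReasoning setoid

  module _ (q : Carrier) where

    -- gauss m n is the Gaussian binomial coefficient [m + n; n].
    gauss : ℕ → ℕ → Carrier
    gauss zero    n       = 1#
    gauss (suc m) zero    = 1#
    gauss (suc m) (suc n) = gauss m (suc n) + q ^ suc m * gauss (suc m) n

    gauss-zeroʳ : ∀ m → gauss m 0 ≡ 1#
    gauss-zeroʳ zero    = ≡.refl
    gauss-zeroʳ (suc m) = ≡.refl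

    -- The second q-Pascal rule, the defining recursion being the first. Having both gives the
    -- symmetry of the coefficient and, later, its quotient formula.
    gauss-pascal : ∀ m n →
      gauss (suc m) (suc n) ≈ q ^ suc n * gauss m (suc n) + gauss (suc m) n
    gauss-pascal zero zero = +-comm _ _
    gauss-pascal zero (suc n) = begin
      1# + q ^ 1 * gauss 1 (suc n)
        ≈⟨ +-congˡ (*-congˡ (gauss-pascal zero n)) ⟩
      1# + q ^ 1 * (q ^ suc n * 1# + gauss 1 n)
        ≈⟨ solve 3 (λ q qⁿ g → con 1 :+ q :* con 1 :* (qⁿ :* con 1 :+ g)
                      := q :* qⁿ :* con 1 :+ (con 1 :+ q :* con 1 :* g)) refl q (q ^ suc n) (gauss 1 n) ⟩
      q ^ suc (suc n) * 1# + gauss 1 (suc n) ∎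
    gauss-pascal (suc m) zero = begin
      gauss (suc m) 1 + q ^ suc (suc m) * 1#
        ≈⟨ +-congʳ (gauss-pascal m zero) ⟩
      q ^ 1 * gauss m 1 + 1# + q ^ suc (suc m) * 1#
        ≈⟨ solve 3 (λ q qᵐ g → q :* con 1 :* g :+ con 1 :+ q :* qᵐ :* con 1
                      := q :* con 1 :* (g :+ qᵐ :* con 1) :+ con 1) refl q (q ^ suc m) (gauss m 1) ⟩
      q ^ 1 * gauss (suc m) 1 + 1# ∎
    gauss-pascal (suc m) (suc n) = begin
      gauss (suc m) (2 ℕ.+ n) + q ^ (2 ℕ.+ m) * gauss (2 ℕ.+ m) (suc n)
        ≈⟨ +-cong (gauss-pascal m (suc n)) (*-congˡ (gauss-pascal (suc m) n)) ⟩
      (q ^ (2 ℕ.+ n) * gauss m (2 ℕ.+ n) + gauss (suc m) (suc n))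
        + q ^ (2 ℕ.+ m) * (q ^ suc n * gauss (suc m) (suc n) + gauss (2 ℕ.+ m) n)
        ≈⟨ solve 6 (λ q qᵐ qⁿ x y z →
               (q :* qⁿ :* x :+ y) :+ q :* qᵐ :* (qⁿ :* y :+ z)
             := q :* qⁿ :* (x :+ qᵐ :* y) :+ (y :+ q :* qᵐ :* z))
             refl q (q ^ suc m) (q ^ suc n) (gauss m (2 ℕ.+ n)) (gauss (suc m) (suc n)) (gauss (2 ℕ.+ m) n) ⟩
      q ^ (2 ℕ.+ n) * gauss (suc m) (2 ℕ.+ n) + gauss (2 ℕ.+ m) (suc n) ∎

    gauss-sym : ∀ m n → gauss m n ≈ gauss n m
    gauss-sym zero    n       = reflexive (≡.sym (gauss-zeroʳ n))
    gauss-sym (suc m) zero    = refl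
    gauss-sym (suc m) (suc n) = begin
      gauss m (suc n) + q ^ suc m * gauss (suc m) n
        ≈⟨ +-cong (gauss-sym m (suc n)) (*-congˡ (gauss-sym (suc m) n)) ⟩
      gauss (suc n) m + q ^ suc m * gauss n (suc m)
        ≈⟨ +-comm _ _ ⟩
      q ^ suc m * gauss n (suc m) + gauss (suc n) m
        ≈⟨ gauss-pascal n m ⟨
      gauss (suc n) (suc m) ∎

    -- Σ_{i<m} gauss (m − 1 − i) (n + 1 + i) · τ i
    gaussSum : (ℕ → Carrier) → ℕ → ℕ → Carrier
    gaussSum τ zero    n = 0#
    gaussSum τ (suc m) n = gauss m (suc n) * τ 0 + gaussSum (τ ∘ suc) m (suc n)

    -- For the half of the theta sum with positive index, where `x` is `a`. The last summand is the
    -- central term carried across the boundary into this half.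
    gaussSum-sucˡ : ∀ {τ} x m n → (∀ i → τ (suc i) ≈ x * q ^ suc i * τ i) →
      gaussSum τ (suc m) n ≈ (1# + x * q ^ m) * gaussSum τ m n + q ^ m * gauss m n * τ 0
    gaussSum-sucˡ {τ} x zero n _ = solve 2 (λ x t → con 1 :* t :+ con 0
      := (con 1 :+ x :* con 1) :* con 0 :+ con 1 :* con 1 :* t) refl x (τ 0)
    gaussSum-sucˡ {τ} x (suc m) n τ-suc = begin
      gauss (suc m) (suc n) * τ 0 + gaussSum (τ ∘ suc) (suc m) (suc n)
        -- Dropping `τ 0` turns the ratio parameter `x` into `x * q`, and (x q) q^m is the x q^(m+1)
        -- of the goal, so the outer factor stays the same.
        ≈⟨ +-congˡ (gaussSum-sucˡ (x * q) m (suc n) τ∘suc-suc) ⟩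
      gauss (suc m) (suc n) * τ 0
        + ((1# + x * q * q ^ m) * gaussSum (τ ∘ suc) m (suc n) + q ^ m * gauss m (suc n) * τ 1)
        ≈⟨ +-congˡ (+-congˡ (*-congˡ (τ-suc 0))) ⟩
      gauss (suc m) (suc n) * τ 0
        + ((1# + x * q * q ^ m) * gaussSum (τ ∘ suc) m (suc n)
           + q ^ m * gauss m (suc n) * (x * q ^ 1 * τ 0))
        ≈⟨ solve 7 (λ q qᵐ x g h s t →
               (g :+ q :* qᵐ :* h) :* t
                 :+ ((con 1 :+ x :* q :* qᵐ) :* s :+ qᵐ :* g :* (x :* (q :* con 1) :* t))
             := (con 1 :+ x :* (q :* qᵐ)) :* (g :* t :+ s) :+ q :* qᵐ :* h :* t)
             refl q (q ^ m) x (gauss m (suc n)) (gauss (suc m) n) (gaussSum (τ ∘ suc) m (suc n)) (τ 0) ⟩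
      (1# + x * q ^ suc m) * gaussSum τ (suc m) n + q ^ suc m * gauss (suc m) n * τ 0 ∎
      where
      τ∘suc-suc : ∀ i → τ (2 ℕ.+ i) ≈ x * q * q ^ suc i * τ (suc i)
      τ∘suc-suc i = trans (τ-suc (suc i)) (*-congʳ (sym (*-assoc x q _)))

    -- For the half with negative index. The second Pascal rule splits each binomial, and the
    -- hypothesis trades the power of q so produced for `z` times the next term; these pieces
    -- reassemble into `z` times the tail.
    gaussSum-sucʳ : ∀ {τ} z n m → (∀ i → z * τ (suc i) ≈ q ^ (2 ℕ.+ (i ℕ.+ m)) * τ i) →
      gaussSum τ (suc n) (suc m) ≈ gaussSum τ (suc n) m + z * gaussSum (τ ∘ suc) n (suc m)
    gaussSum-sucʳ {τ} z zero m _ = solve 2 (λ z t → con 1 :* t :+ con 0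
      := con 1 :* t :+ con 0 :+ z :* con 0) refl z (τ 0)
    gaussSum-sucʳ {τ} z (suc n) m τ-suc = begin
      gauss (suc n) (2 ℕ.+ m) * τ 0 + gaussSum (τ ∘ suc) (suc n) (2 ℕ.+ m)
        ≈⟨ +-cong (*-congʳ (gauss-pascal n (suc m))) (gaussSum-sucʳ z n (suc m) τ∘suc-suc) ⟩
      (q ^ (2 ℕ.+ m) * g + h) * τ 0 + (s + z * u)
        ≈⟨ solve 7 (λ p g h t s z u → (p :* g :+ h) :* t :+ (s :+ z :* u)
                                   := h :* t :+ g :* (p :* t) :+ (s :+ z :* u))
             refl (q ^ (2 ℕ.+ m)) g h (τ 0) s z u ⟩
      h * τ 0 + g * (q ^ (2 ℕ.+ m) * τ 0) + (s + z * u)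
        ≈⟨ +-congʳ (+-congˡ (*-congˡ (τ-suc 0))) ⟨
      h * τ 0 + g * (z * τ 1) + (s + z * u)
        ≈⟨ solve 7 (λ t′ g h t s z u → h :* t :+ g :* (z :* t′) :+ (s :+ z :* u)
                                   := h :* t :+ s :+ z :* (g :* t′ :+ u))
             refl (τ 1) g h (τ 0) s z u ⟩
      h * τ 0 + s + z * (g * τ 1 + u) ∎
      where
      g h s u : Carrier
      g = gauss n (2 ℕ.+ m)
      h = gauss (suc n) (suc m)
      s = gaussSum (τ ∘ suc) (suc n) (suc m)
      u = gaussSum (τ ∘ suc ∘ suc) n (2 ℕ.+ m)
      τ∘suc-suc : ∀ i → z * τ (2 ℕ.+ i) ≈ q ^ (2 ℕ.+ (i ℕ.+ suc m)) * τ (suc i)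
      τ∘suc-suc i = trans (τ-suc (suc i))
        (*-congʳ (reflexive (≡.cong (λ k → q ^ (2 ℕ.+ k)) (≡.sym (ℕ.+-suc i m)))))

  -- The term of index k + 1 in the bilateral series Σ a^(k(k+1)/2) b^(k(k-1)/2); exchanging `a` and
  -- `b` gives the term of index -(k + 1).
  thetaTerm : Carrier → Carrier → ℕ → Carrier
  thetaTerm a b k = a ^ triangular (suc k) * b ^ triangular k

  thetaTerm-zero : ∀ a b → thetaTerm a b 0 ≈ a
  thetaTerm-zero a b = solve 1 (λ a → a :* con 1 :* con 1 := a) refl a

  thetaTerm-suc : ∀ a b k → thetaTerm a b (suc k) ≈ a * (a * b) ^ suc k * thetaTerm a b k
  thetaTerm-suc a b k = begin
    a ^ (2 ℕ.+ k ℕ.+ triangular (suc k)) * b ^ (suc k ℕ.+ triangular k)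
      ≈⟨ *-cong (^-homo-* a (2 ℕ.+ k) (triangular (suc k))) (^-homo-* b (suc k) (triangular k)) ⟩
    (a * a ^ suc k * a ^ triangular (suc k)) * (b ^ suc k * b ^ triangular k)
      ≈⟨ solve 5 (λ a aᵏ bᵏ u v → (a :* aᵏ :* u) :* (bᵏ :* v) := a :* (aᵏ :* bᵏ) :* (u :* v))
           refl a (a ^ suc k) (b ^ suc k) (a ^ triangular (suc k)) (b ^ triangular k) ⟩
    a * (a ^ suc k * b ^ suc k) * (a ^ triangular (suc k) * b ^ triangular k)
      ≈⟨ *-congʳ (*-congˡ (^-distrib-* a b (suc k))) ⟨
    a * (a * b) ^ suc k * thetaTerm a b k ∎

  module _ (a b : Carrier) where
    private
      q : Carrier
      q = a * b

    -- The bilateral sum over -n ≤ k ≤ m of the theta terms weighted by the Gaussian binomials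
    -- [m + n; m - k], cut at k = 0 into a centre and two halves.
    finiteTheta : ℕ → ℕ → Carrier
    finiteTheta m n = gauss q m n + gaussSum q (thetaTerm a b) m n + gaussSum q (thetaTerm b a) n m

    private
      dual : ∀ m i → (a * q ^ m) * thetaTerm b a (suc i) ≈ q ^ (2 ℕ.+ (i ℕ.+ m)) * thetaTerm b a i
      dual m i = begin
        (a * q ^ m) * thetaTerm b a (suc i)
          ≈⟨ *-congˡ (thetaTerm-suc b a i) ⟩
        (a * q ^ m) * (b * (b * a) ^ suc i * thetaTerm b a i)
          ≈⟨ *-congˡ (*-congʳ (*-congˡ (^-congˡ (suc i) (*-comm b a)))) ⟩
        (a * q ^ m) * (b * q ^ suc i * thetaTerm b a i)
          ≈⟨ solve 5 (λ a b qᵐ qⁱ t → (a :* qᵐ) :* (b :* ((a :* b) :* qⁱ) :* t)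
                        := (a :* b) :* ((a :* b) :* (qⁱ :* qᵐ)) :* t)
               refl a b (q ^ m) (q ^ i) (thetaTerm b a i) ⟩
        q * (q * (q ^ i * q ^ m)) * thetaTerm b a i
          ≈⟨ *-congʳ (*-congˡ (*-congˡ (^-homo-* q i m))) ⟨
        q ^ (2 ℕ.+ (i ℕ.+ m)) * thetaTerm b a i ∎

    -- Multiplication by a q^m moves terms up by one index. The boundary summand of `gaussSum-sucˡ`
    -- is the central term moved up, and the q^(m+1) in the recursion for the central binomial is
    -- the first negative term moved up.
    finiteTheta-sucˡ : ∀ m n → finiteTheta (suc m) n ≈ (1# + a * q ^ m) * finiteTheta m n
    finiteTheta-sucˡ m zero = begin
      1# + gaussSum q (thetaTerm a b) (suc m) 0 + 0#
        ≈⟨ +-congʳ (+-congˡ (gaussSum-sucˡ q a m 0 (thetaTerm-suc a b))) ⟩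
      1# + ((1# + a * q ^ m) * s + q ^ m * gauss q m 0 * thetaTerm a b 0) + 0#
        ≈⟨ +-congʳ (+-congˡ (+-congˡ (*-cong (*-congˡ (reflexive (gauss-zeroʳ q m))) (thetaTerm-zero a b)))) ⟩
      1# + ((1# + a * q ^ m) * s + q ^ m * 1# * a) + 0#
        ≈⟨ solve 3 (λ a qᵐ s →
               con 1 :+ ((con 1 :+ a :* qᵐ) :* s :+ qᵐ :* con 1 :* a) :+ con 0
             := (con 1 :+ a :* qᵐ) :* (con 1 :+ s :+ con 0)) refl a (q ^ m) s ⟩
      (1# + a * q ^ m) * (1# + s + 0#)
        ≈⟨ *-congˡ (+-congʳ (+-congʳ (reflexive (gauss-zeroʳ q m)))) ⟨
      (1# + a * q ^ m) * finiteTheta m zero ∎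
      where
      s : Carrier
      s = gaussSum q (thetaTerm a b) m 0
    finiteTheta-sucˡ m (suc n) = begin
      gauss q (suc m) (suc n) + gaussSum q (thetaTerm a b) (suc m) (suc n)
        + gaussSum q (thetaTerm b a) (suc n) (suc m)
        ≈⟨ +-cong (+-congˡ (trans (gaussSum-sucˡ q a m (suc n) (thetaTerm-suc a b))
                     (+-congˡ (*-congˡ (thetaTerm-zero a b)))))
             (trans (gaussSum-sucʳ q (a * q ^ m) n m (dual m))
                (+-congʳ (+-congʳ (*-cong (gauss-sym q n (suc m)) (thetaTerm-zero b a))))) ⟩
      (g + q ^ suc m * h) + ((1# + a * q ^ m) * s + q ^ m * g * a) + ((h * b + u) + (a * q ^ m) * u)
        ≈⟨ solve 7 (λ a b qᵐ g h s u →
               (g :+ (a :* b) :* qᵐ :* h) :+ ((con 1 :+ a :* qᵐ) :* s :+ qᵐ :* g :* a)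
                 :+ ((h :* b :+ u) :+ (a :* qᵐ) :* u)
             := (con 1 :+ a :* qᵐ) :* (g :+ s :+ (h :* b :+ u))) refl a b (q ^ m) g h s u ⟩
      (1# + a * q ^ m) * (g + s + (h * b + u))
        ≈⟨ *-congˡ (+-congˡ (+-congʳ (*-cong (gauss-sym q n (suc m)) (thetaTerm-zero b a)))) ⟨
      (1# + a * q ^ m) * finiteTheta m (suc n) ∎
      where
      g h s u : Carrier
      g = gauss q m (suc n)
      h = gauss q (suc m) n
      s = gaussSum q (thetaTerm a b) m (suc n)
      u = gaussSum q (thetaTerm b a ∘ suc) n (suc m)

  gauss-cong : ∀ {q r} → q ≈ r → ∀ m n → gauss q m n ≈ gauss r m n
  gauss-cong q≈r zero    n       = refl
  gauss-cong q≈r (suc m) zero    = refl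
  gauss-cong q≈r (suc m) (suc n) = +-cong (gauss-cong q≈r m (suc n))
    (*-cong (^-congˡ (suc m) q≈r) (gauss-cong q≈r (suc m) n))

  gaussSum-cong : ∀ {q r} → q ≈ r → ∀ τ m n → gaussSum q τ m n ≈ gaussSum r τ m n
  gaussSum-cong q≈r τ zero    n = refl
  gaussSum-cong q≈r τ (suc m) n = +-cong (*-congʳ (gauss-cong q≈r m (suc n)))
    (gaussSum-cong q≈r (τ ∘ suc) m (suc n))

  finiteTheta-swap : ∀ a b m n → finiteTheta a b m n ≈ finiteTheta b a n m
  finiteTheta-swap a b m n = begin
    gauss (a * b) m n + gaussSum (a * b) (thetaTerm a b) m n + gaussSum (a * b) (thetaTerm b a) n m
      ≈⟨ +-cong (+-cong (trans (gauss-sym (a * b) m n) (gauss-cong (*-comm a b) n m))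
           (gaussSum-cong (*-comm a b) _ m n)) (gaussSum-cong (*-comm a b) _ n m) ⟩
    gauss (b * a) n m + gaussSum (b * a) (thetaTerm a b) m n + gaussSum (b * a) (thetaTerm b a) n m
      ≈⟨ solve 3 (λ g s t → g :+ s :+ t := g :+ t :+ s) refl _ _ _ ⟩
    gauss (b * a) n m + gaussSum (b * a) (thetaTerm b a) n m + gaussSum (b * a) (thetaTerm a b) m n ∎

  open RangeFold *-commutativeMonoid

  -- `finiteTheta-sucˡ` supplies the factors in `a`. At m = 0 the reflection of k to -k lets the
  -- same lemma supply those in `b`.
  finiteTripleProduct : ∀ a b m n → finiteTheta a b m n
    ≈ fold (λ i → 1# + a * (a * b) ^ i) m * fold (λ i → 1# + b * (a * b) ^ i) n
  finiteTripleProduct a b zero zero = solve 0 (con 1 :+ con 0 :+ con 0 := con 1 :* con 1) refl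
  finiteTripleProduct a b zero (suc n) = begin
    finiteTheta a b 0 (suc n)
      ≈⟨ finiteTheta-swap a b 0 (suc n) ⟩
    finiteTheta b a (suc n) 0
      ≈⟨ finiteTheta-sucˡ b a n 0 ⟩
    (1# + b * (b * a) ^ n) * finiteTheta b a n 0
      ≈⟨ *-cong (+-congˡ (*-congˡ (^-congˡ n (*-comm b a))))
                (trans (finiteTheta-swap b a n 0) (finiteTripleProduct a b 0 n)) ⟩
    (1# + b * (a * b) ^ n) * (1# * fold (λ i → 1# + b * (a * b) ^ i) n)
      ≈⟨ solve 2 (λ x p → x :* (con 1 :* p) := con 1 :* (p :* x)) refl _ _ ⟩
    1# * (fold (λ i → 1# + b * (a * b) ^ i) n * (1# + b * (a * b) ^ n))
      ≈⟨ *-congˡ (fold-snoc (λ i → 1# + b * (a * b) ^ i) n) ⟨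
    1# * fold (λ i → 1# + b * (a * b) ^ i) (suc n) ∎
  finiteTripleProduct a b (suc m) n = begin
    finiteTheta a b (suc m) n
      ≈⟨ finiteTheta-sucˡ a b m n ⟩
    (1# + a * (a * b) ^ m) * finiteTheta a b m n
      ≈⟨ *-congˡ (finiteTripleProduct a b m n) ⟩
    (1# + a * (a * b) ^ m) * (fold (λ i → 1# + a * (a * b) ^ i) m * fold (λ i → 1# + b * (a * b) ^ i) n)
      ≈⟨ solve 3 (λ x p r → x :* (p :* r) := p :* x :* r) refl _ _ _ ⟩
    fold (λ i → 1# + a * (a * b) ^ i) m * (1# + a * (a * b) ^ m) * fold (λ i → 1# + b * (a * b) ^ i) n
      ≈⟨ *-congʳ (fold-snoc (λ i → 1# + a * (a * b) ^ i) m) ⟨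
    fold (λ i → 1# + a * (a * b) ^ i) (suc m) * fold (λ i → 1# + b * (a * b) ^ i) n ∎

-- Passage to the limit: theta series and infinite products

module Theta {c ℓ} (R : CommutativeRing c ℓ) where
  open PowerSeries R
  open GaussianBinomial commutativeSemiring
  open SemiringSolver commutativeSemiring using (solve; _:=_; _:+_; _:*_; _:^_; con)
  open SetoidReasoning setoid

  -- poch a q is ∏_{i≥0} (1 + a qⁱ), usually written (−a; q)_∞.
  poch : Series → Series → Series
  poch a q = Π.fold∞ (λ i → 1# + a * q ^ i)

  poch-convergent : ∀ a {q} → NoConstant q → Π.Convergent (λ i → 1# + a * q ^ i)
  poch-convergent a q₀ i = 1+-zero[] (*-zero[] a (noConstant-^ q₀ i))

  poch-cong : ∀ {a b q r} → a ≈ b → q ≈ r → poch a q ≈ poch b r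
  poch-cong a≈b q≈r = Π.fold∞-cong (λ i → +-congˡ {x = 1#} (*-cong a≈b (^-congˡ i q≈r)))

  poch-unit : ∀ {a q} → NoConstant a → NoConstant q → Unit (poch a q)
  poch-unit {a} a₀ q₀ = trans[] (Π.fold∞-truncate (poch-convergent a q₀) {1} ℕ.≤-refl)
    (*-one[] (1+-zero[] (zero[]-* 1# a₀)) refl[])

  theta : Series → Series → Series
  theta a b = 1# + Σ.fold∞ (λ k → thetaTerm a b k + thetaTerm b a k)

  k≤triangular : ∀ k → k ℕ.≤ triangular k
  k≤triangular zero    = z≤n
  k≤triangular (suc k) = ℕ.m≤m+n (suc k) (triangular k)

  thetaTerm-convergent : ∀ {a} → NoConstant a → ∀ b → Σ.Convergent (thetaTerm a b)
  thetaTerm-convergent {a} a₀ b k = zero[]-* (b ^ triangular k)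
    (≈[]-weaken (ℕ.≤-trans (ℕ.n≤1+n k) (k≤triangular (suc k))) (noConstant-^ a₀ (triangular (suc k))))

  private
    module _ (q : Series) where

      -- The quotient of neighbouring binomials, cleared of denominators. The two Pascal rules
      -- expand the same binomial; expanding it by one rule and its multiple by q^(n+1) by the other
      -- makes the `x` parts cancel.
      gauss-step : ∀ m n →
        gauss q m (suc n) * (1# + - q * q ^ n) ≈ gauss q m n * (1# + - q * q ^ (n ℕ.+ m))
      gauss-step zero n = *-congˡ {x = 1#} (+-congˡ (*-congˡ (^-congʳ q (≡.sym (ℕ.+-identityʳ n)))))
      gauss-step (suc m) n = begin
        (x + u * y) * (1# + v′)
          ≈⟨ solve 2 (λ g v′ → g :* (con 1 :+ v′) := g :+ v′ :* g) refl (x + u * y) v′ ⟩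
        (x + u * y) + v′ * (x + u * y)
          ≈⟨ +-congʳ (gauss-pascal q m n) ⟩
        (q * q ^ n * x + y) + - q * q ^ n * (x + u * y)
          ≈⟨ solve 6 (λ q -q qⁿ u x y → (q :* qⁿ :* x :+ y) :+ -q :* qⁿ :* (x :+ u :* y)
                          := (q :+ -q) :* (qⁿ :* x) :+ y :* (con 1 :+ -q :* (qⁿ :* u)))
               refl q (- q) (q ^ n) u x y ⟩
        (q + - q) * (q ^ n * x) + y * (1# + - q * (q ^ n * u))
          ≈⟨ +-cong (trans (*-congʳ (-‿inverseʳ q)) (zeroˡ _))
               (*-congˡ (+-congˡ (*-congˡ (sym (^-homo-* q n (suc m)))))) ⟩
        0# + y * (1# + - q * q ^ (n ℕ.+ suc m))
          ≈⟨ +-identityˡ _ ⟩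
        y * (1# + - q * q ^ (n ℕ.+ suc m)) ∎
        where
        x y u v′ : Series
        x = gauss q m (suc n)
        y = gauss q (suc m) n
        u = q ^ suc m
        v′ = - q * q ^ n

      gauss-product : ∀ m n → gauss q m n * Π.fold (λ i → 1# + - q * q ^ i) n
                            ≈ Π.fold (λ i → 1# + - q * q ^ (i ℕ.+ m)) n
      gauss-product m zero    = trans (*-identityʳ _) (reflexive (gauss-zeroʳ q m))
      gauss-product m (suc n) = begin
        gauss q m (suc n) * Π.fold (λ i → 1# + - q * q ^ i) (suc n)
          ≈⟨ *-congˡ (Π.fold-snoc (λ i → 1# + - q * q ^ i) n) ⟩
        gauss q m (suc n) * (Π.fold (λ i → 1# + - q * q ^ i) n * (1# + - q * q ^ n))
          ≈⟨ solve 3 (λ g p x → g :* (p :* x) := g :* x :* p) refl _ _ _ ⟩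
        gauss q m (suc n) * (1# + - q * q ^ n) * Π.fold (λ i → 1# + - q * q ^ i) n
          ≈⟨ *-congʳ (gauss-step m n) ⟩
        gauss q m n * (1# + - q * q ^ (n ℕ.+ m)) * Π.fold (λ i → 1# + - q * q ^ i) n
          ≈⟨ solve 3 (λ g x p → g :* x :* p := g :* p :* x) refl _ _ _ ⟩
        gauss q m n * Π.fold (λ i → 1# + - q * q ^ i) n * (1# + - q * q ^ (n ℕ.+ m))
          ≈⟨ *-congʳ (gauss-product m n) ⟩
        Π.fold (λ i → 1# + - q * q ^ (i ℕ.+ m)) n * (1# + - q * q ^ (n ℕ.+ m))
          ≈⟨ Π.fold-snoc (λ i → 1# + - q * q ^ (i ℕ.+ m)) n ⟨
        Π.fold (λ i → 1# + - q * q ^ (i ℕ.+ m)) (suc n) ∎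

      module _ (q₀ : NoConstant q) where

        -- By `gauss-product` the binomial is (q^(m+1);q)_n over (q;q)_n, and the numerator is 1
        -- modulo X^N once m ≥ N.
        gauss-limit : ∀ {N m n} → N ℕ.≤ m → N ℕ.≤ n → poch (- q) q * gauss q m n ≈[ N ] 1#
        gauss-limit {N} {m} {n} N≤m N≤n = trans[]
          (*-cong[] (Π.fold∞-truncate (poch-convergent (- q) q₀) N≤n) refl[])
          (trans[] (≈⇒≈[] (trans (*-comm _ _) (gauss-product m n)))
            (Π.fold-one[] (λ i → 1+-zero[] (*-zero[] (- q)
              (≈[]-weaken (ℕ.≤-trans N≤m (ℕ.m≤n+m m i)) (noConstant-^ q₀ (i ℕ.+ m))))) n))

        -- The i-th term of gaussSum is [m + n; m − 1 − i] · τ i: either i is large and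
        -- τ i is negligible, or both indices of the binomial are large.
        gaussSum-limit : ∀ {N} k m {n τ} → (∀ i → τ i ≈[ i ℕ.+ k ] 0#) →
          N ℕ.≤ n → N ℕ.+ N ℕ.≤ m ℕ.+ k → poch (- q) q * gaussSum q τ m n ≈[ N ] Σ.fold τ m
        gaussSum-limit k zero _ _ _ = ≈⇒≈[] (zeroʳ _)
        gaussSum-limit {N} k (suc m) {n} {τ} small N≤n 2N≤ = trans[]
          (≈⇒≈[] (solve 4 (λ e g t s → e :* (g :* t :+ s) := e :* g :* t :+ e :* s) refl _ _ _ _))
          (+-cong[] head (gaussSum-limit (suc k) m
            (λ i → ≡.subst (λ j → τ (suc i) ≈[ j ] 0#) (≡.sym (ℕ.+-suc i k)) (small (suc i)))
            (ℕ.m≤n⇒m≤1+n N≤n) (ℕ.≤-trans 2N≤ (ℕ.≤-reflexive (≡.sym (ℕ.+-suc m k))))))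
          where
          head : poch (- q) q * gauss q m (suc n) * τ 0 ≈[ N ] τ 0
          head with ℕ.≤-<-connex N k
          ... | inj₁ N≤k = trans[] (*-zero[] _ τ₀) (sym[] τ₀)
            where
            τ₀ : τ 0 ≈[ N ] 0#
            τ₀ = ≈[]-weaken N≤k (small 0)
          ... | inj₂ k<N = trans[]
            (*-cong[] (gauss-limit (ℕ.+-cancelʳ-≤ N N m (ℕ.≤-trans 2N≤
                (ℕ.≤-trans (ℕ.≤-reflexive (≡.sym (ℕ.+-suc m k))) (ℕ.+-monoʳ-≤ m k<N))))
              (ℕ.m≤n⇒m≤1+n N≤n)) refl[])
            (≈⇒≈[] (*-identityˡ (τ 0)))

  jacobiTripleProduct : ∀ {a b} → NoConstant a → NoConstant b →
    theta a b ≈ poch a (a * b) * poch b (a * b) * poch (- (a * b)) (a * b)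
  jacobiTripleProduct {a} {b} a₀ b₀ = ≈[]⇒≈ λ N → sym[] (trans[]
    -- Accuracy N requires cutting at 2N: terms with i ≥ N vanish to order N, and those with i < N
    -- keep 2N - 1 - i ≥ N in their binomial.
    (*-cong[] (*-cong[] (Π.fold∞-truncate (poch-convergent a q₀) (ℕ.m≤m+n N N))
                        (Π.fold∞-truncate (poch-convergent b q₀) (ℕ.m≤m+n N N))) refl[])
    (trans[] (≈⇒≈[] (trans (*-congʳ (sym (finiteTripleProduct a b (N ℕ.+ N) (N ℕ.+ N))))
               (solve 4 (λ e g s t → (g :+ s :+ t) :* e := e :* g :+ (e :* s :+ e :* t)) refl e _ _ _)))
    (trans[] (+-cong[] (gauss-limit q q₀ (ℕ.m≤m+n N N) (ℕ.m≤m+n N N))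
               (+-cong[] (sumLimit N (thetaTerm-convergent a₀ b)) (sumLimit N (thetaTerm-convergent b₀ a))))
    (+-cong[] refl[] (trans[] (≈⇒≈[] (sym (Σ.fold-∙ (thetaTerm a b) (thetaTerm b a) (N ℕ.+ N))))
      (sym[] (Σ.fold∞-truncate
        (λ k → +-zero[] (thetaTerm-convergent a₀ b k) (thetaTerm-convergent b₀ a k)) (ℕ.m≤m+n N N))))))))
    where
    q e : Series
    q = a * b
    e = poch (- q) q
    q₀ : NoConstant q
    q₀ = zero[]-* b a₀
    sumLimit : ∀ N {τ} → Σ.Convergent τ →
      e * gaussSum q τ (N ℕ.+ N) (N ℕ.+ N) ≈[ N ] Σ.fold τ (N ℕ.+ N)
    sumLimit N {τ} small = gaussSum-limit q q₀ 0 (N ℕ.+ N)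
      (λ i → ≡.subst (λ j → τ i ≈[ j ] 0#) (≡.sym (ℕ.+-identityʳ i)) (small i))
      (ℕ.m≤m+n N N) (ℕ.m≤m+n (N ℕ.+ N) 0)

  -- Splitting infinite products by residue classes

  poch-split : ∀ k .{{_ : ℕ.NonZero k}} a {q} → NoConstant q →
    poch a q ≈ Π.fold∞ (λ i → Π.fold (λ j → 1# + a * q ^ j * (q ^ k) ^ i) k)
  poch-split k a {q} q₀ = trans (Π.fold∞-blocks k (poch-convergent a q₀))
    (Π.fold∞-cong (λ i → Π.fold-cong (λ j → +-congˡ {x = 1#} (trans
      (*-congˡ (trans (^-homo-* q j (i ℕ.* k)) (*-congˡ (trans (^-congʳ q (ℕ.*-comm i k)) (sym (^-assocʳ q k i))))))
      (sym (*-assoc a _ _)))) k))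

  poch-split₂ : ∀ a {q} → NoConstant q → poch a q ≈ poch a (q ^ 2) * poch (a * q) (q ^ 2)
  poch-split₂ a {q} q₀ = trans (poch-split 2 a q₀) (trans
    (Π.fold∞-cong (λ i → solve 3 (λ a q z →
        (con 1 :+ a :* con 1 :* z) :* ((con 1 :+ a :* (q :* con 1) :* z) :* con 1)
      := (con 1 :+ a :* z) :* (con 1 :+ a :* q :* z)) refl a q ((q ^ 2) ^ i)))
    (Π.fold∞-∙ (poch-convergent a q²₀) (poch-convergent (a * q) q²₀)))
    where
    q²₀ : NoConstant (q ^ 2)
    q²₀ = zero[]-* (q ^ 1) q₀

  poch-split₃ : ∀ a {q} → NoConstant q →
    poch a q ≈ poch a (q ^ 3) * poch (a * q) (q ^ 3) * poch (a * q ^ 2) (q ^ 3)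
  poch-split₃ a {q} q₀ = trans (poch-split 3 a q₀) (trans
    (Π.fold∞-cong (λ i → solve 3 (λ a q z →
        (con 1 :+ a :* con 1 :* z) :* ((con 1 :+ a :* (q :* con 1) :* z)
          :* ((con 1 :+ a :* (q :* (q :* con 1)) :* z) :* con 1))
      := (con 1 :+ a :* z) :* (con 1 :+ a :* q :* z) :* (con 1 :+ a :* (q :* (q :* con 1)) :* z))
      refl a q ((q ^ 3) ^ i)))
    (trans (Π.fold∞-∙ (λ i → *-one[] (poch-convergent a q³₀ i) (poch-convergent (a * q) q³₀ i))
                      (poch-convergent (a * q ^ 2) q³₀))
           (*-congʳ (Π.fold∞-∙ (poch-convergent a q³₀) (poch-convergent (a * q) q³₀)))))
    where
    q³₀ : NoConstant (q ^ 3)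
    q³₀ = zero[]-* (q ^ 2) q₀

  poch-conj : ∀ a {q} → NoConstant q → poch a q * poch (- a) q ≈ poch (- (a * a)) (q ^ 2)
  poch-conj a {q} q₀ = trans (sym (Π.fold∞-∙ (poch-convergent a q₀) (poch-convergent (- a) q₀)))
    (Π.fold∞-cong λ i → begin
      (1# + a * q ^ i) * (1# + - a * q ^ i)
        ≈⟨ solve 3 (λ a b z → (con 1 :+ a :* z) :* (con 1 :+ b :* z)
                           := con 1 :+ (a :+ b) :* z :+ b :* a :* (z :* z)) refl a (- a) (q ^ i) ⟩
      1# + (a + - a) * q ^ i + - a * a * (q ^ i * q ^ i)
        ≈⟨ +-cong (trans (+-congˡ (trans (*-congʳ (-‿inverseʳ a)) (zeroˡ _))) (+-identityʳ 1#))
             (*-cong (sym (-‿distribˡ-* a a)) (square i)) ⟩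
      1# + - (a * a) * (q ^ 2) ^ i ∎)
    where
    square : ∀ i → q ^ i * q ^ i ≈ (q ^ 2) ^ i
    square i = trans (sym (^-distrib-* q q i)) (^-congˡ i (*-congˡ (sym (*-identityʳ q))))

  -- Ramanujan's ψ and φ

  neg-square : ∀ y → (- y) ^ 2 ≈ y ^ 2
  neg-square y = begin
    - y * (- y * 1#)   ≈⟨ *-congˡ (*-identityʳ (- y)) ⟩
    - y * - y          ≈⟨ -‿distribˡ-* y (- y) ⟨
    - (y * - y)        ≈⟨ -‿cong (-‿distribʳ-* y y) ⟨
    - - (y * y)        ≈⟨ -‿involutive (y * y) ⟩
    y * y              ≈⟨ *-congˡ (*-identityʳ y) ⟨
    y ^ 2              ∎

  neg-cube : ∀ y → (- y) ^ 3 ≈ - (y ^ 3)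
  neg-cube y = trans (*-congˡ (neg-square y)) (sym (-‿distribˡ-* y (y ^ 2)))

  neg-fourth : ∀ y → (- y) ^ 4 ≈ y ^ 4
  neg-fourth y = trans (sym (^-assocʳ (- y) 2 2)) (trans (^-congˡ 2 (neg-square y)) (^-assocʳ y 2 2))

  noConstant-^suc : ∀ {y} n → NoConstant y → NoConstant (y ^ suc n)
  noConstant-^suc {y} n y₀ = zero[]-* (y ^ n) y₀

  psi : Series → Series
  psi y = theta y (y ^ 3)

  phi : Series → Series
  phi y = theta y y

  psi-product : ∀ {y} → NoConstant y → psi y ≈ poch y (y ^ 2) * poch (- (y ^ 4)) (y ^ 4)
  psi-product {y} y₀ = trans (jacobiTripleProduct y₀ (noConstant-^suc 2 y₀)) (*-congʳ (sym
    (trans (poch-split₂ y (noConstant-^suc 1 y₀))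
      (*-cong (poch-cong refl (^-assocʳ y 2 2)) (poch-cong refl (^-assocʳ y 2 2))))))

  psi-neg-product : ∀ {y} → NoConstant y → psi (- y) ≈ poch (- y) (y ^ 2) * poch (- (y ^ 4)) (y ^ 4)
  psi-neg-product {y} y₀ = trans (psi-product (noConstant-neg y₀))
    (*-cong (poch-cong refl (neg-square y)) (poch-cong (-‿cong (neg-fourth y)) (neg-fourth y)))

  phi-product : ∀ {y} → NoConstant y →
    phi y ≈ poch y (y ^ 2) * poch y (y ^ 2) * poch (- (y ^ 2)) (y ^ 2)
  phi-product {y} y₀ = trans (jacobiTripleProduct y₀ y₀)
    (*-cong (*-cong (poch-cong refl yy) (poch-cong refl yy)) (poch-cong (-‿cong yy) yy))
    where
    yy : y * y ≈ y ^ 2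
    yy = *-congˡ (sym (*-identityʳ y))

  phi-neg-product : ∀ {y} → NoConstant y →
    phi (- y) ≈ poch (- y) (y ^ 2) * poch (- y) (y ^ 2) * poch (- (y ^ 2)) (y ^ 2)
  phi-neg-product {y} y₀ = trans (phi-product (noConstant-neg y₀))
    (*-cong (*-cong (poch-cong refl y²) (poch-cong refl y²)) (poch-cong (-‿cong y²) y²))
    where
    y² : (- y) ^ 2 ≈ y ^ 2
    y² = neg-square y

  -- Both sides become the same product once (y²;y²)_∞ is split into (y²;y⁴)_∞ (y⁴;y⁴)_∞ and
  -- (y;y²)_∞ (-y;y²)_∞ is contracted to (y²;y⁴)_∞.
  phi-psi : ∀ {y} → NoConstant y → phi (- y) * psi y ≈ psi (- y) * phi (- (y ^ 2))
  phi-psi {y} y₀ = begin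
    phi (- y) * psi y
      ≈⟨ *-cong (phi-neg-product y₀) (psi-product y₀) ⟩
    e * e * w * (p * z)
      ≈⟨ *-congʳ (*-congˡ w≈uz) ⟩
    e * e * (u * z) * (p * z)
      ≈⟨ solve 4 (λ e u z p → e :* e :* (u :* z) :* (p :* z) := e :* z :* ((p :* e) :* u :* z)) refl e u z p ⟩
    e * z * ((p * e) * u * z)
      ≈⟨ *-congˡ (*-congʳ (*-congʳ pe≈u)) ⟩
    e * z * (u * u * z)
      ≈⟨ *-cong (psi-neg-product y₀) phi-neg ⟨
    psi (- y) * phi (- (y ^ 2)) ∎
    where
    e p w u z : Series
    e = poch (- y) (y ^ 2)
    p = poch y (y ^ 2)
    w = poch (- (y ^ 2)) (y ^ 2)
    u = poch (- (y ^ 2)) (y ^ 4)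
    z = poch (- (y ^ 4)) (y ^ 4)
    y²₀ : NoConstant (y ^ 2)
    y²₀ = noConstant-^suc 1 y₀
    phi-neg : phi (- (y ^ 2)) ≈ u * u * z
    phi-neg = trans (phi-neg-product y²₀) (*-cong
      (*-cong (poch-cong refl (^-assocʳ y 2 2)) (poch-cong refl (^-assocʳ y 2 2)))
      (poch-cong (-‿cong (^-assocʳ y 2 2)) (^-assocʳ y 2 2)))
    w≈uz : w ≈ u * z
    w≈uz = trans (poch-split₂ (- (y ^ 2)) y²₀) (*-cong (poch-cong refl (^-assocʳ y 2 2))
      (poch-cong (trans (sym (-‿distribˡ-* (y ^ 2) (y ^ 2))) (-‿cong (sym (^-homo-* y 2 2)))) (^-assocʳ y 2 2)))
    pe≈u : p * e ≈ u
    pe≈u = trans (poch-conj y y²₀) (poch-cong (-‿cong (*-congˡ (sym (*-identityʳ y)))) (^-assocʳ y 2 2))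

  poch-neg-split : ∀ {y} → NoConstant y → poch (- y) y ≈ poch (- y) (y ^ 2) * poch (- (y ^ 2)) (y ^ 2)
  poch-neg-split {y} y₀ = trans (poch-split₂ (- y) y₀) (*-congˡ
    (poch-cong (trans (sym (-‿distribˡ-* y y)) (-‿cong (*-congˡ (sym (*-identityʳ y))))) refl))

  -- Euler's theorem on partitions into distinct and into odd parts. Multiplied by (y²;y²)_∞, the
  -- odd product becomes (y;y)_∞, whose product with (-y;y)_∞ is (y²;y²)_∞ again.
  euler : ∀ {y} → NoConstant y → poch y y * poch (- y) (y ^ 2) ≈ 1#
  euler {y} y₀ = unit-cancel (poch-unit (noConstant-neg (noConstant-^suc 1 y₀)) (noConstant-^suc 1 y₀)) (begin
    w * (poch y y * e)      ≈⟨ solve 3 (λ w g e → w :* (g :* e) := g :* (e :* w)) refl w (poch y y) e ⟩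
    poch y y * (e * w)      ≈⟨ *-congˡ (poch-neg-split y₀) ⟨
    poch y y * poch (- y) y ≈⟨ poch-conj y y₀ ⟩
    poch (- (y * y)) (y ^ 2) ≈⟨ poch-cong (-‿cong (*-congˡ (sym (*-identityʳ y)))) refl ⟩
    w                       ≈⟨ *-identityʳ w ⟨
    w * 1#                  ∎)
    where
    e w : Series
    e = poch (- y) (y ^ 2)
    w = poch (- (y ^ 2)) (y ^ 2)

  powers-convergent : ∀ {y} → NoConstant y → Σ.Convergent (λ k → y ^ triangular k)
  powers-convergent y₀ k = ≈[]-weaken (k≤triangular k) (noConstant-^ y₀ (triangular k))

  convergent-suc : ∀ {s} → Σ.Convergent s → Σ.Convergent (s ∘ suc)
  convergent-suc small i = ≈[]-weaken (ℕ.n≤1+n i) (small (suc i))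

  convergent-^ : ∀ {s} k → Σ.Convergent s → Σ.Convergent (λ i → s i ^ suc k)
  convergent-^ {s} k small i = zero[]-* (s i ^ k) (small i)

  thetaTerm-cong : ∀ {a a′ b b′} → a ≈ a′ → b ≈ b′ → ∀ k → thetaTerm a b k ≈ thetaTerm a′ b′ k
  thetaTerm-cong p q k = *-cong (^-congˡ (triangular (suc k)) p) (^-congˡ (triangular k) q)

  theta-cong : ∀ {a a′ b b′} → a ≈ a′ → b ≈ b′ → theta a b ≈ theta a′ b′
  theta-cong p q = +-congˡ (Σ.fold∞-cong λ k → +-cong (thetaTerm-cong p q k) (thetaTerm-cong q p k))

  psi-unit : ∀ {y} → NoConstant y → Unit (psi y)
  psi-unit y₀ = trans[] (≈⇒≈[] (psi-product y₀)) (*-one[]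
    (poch-unit y₀ (noConstant-^suc 1 y₀)) (poch-unit (noConstant-neg (noConstant-^suc 3 y₀)) (noConstant-^suc 3 y₀)))

-- Dissections in characteristic 3

private
  -- The right side is the exponent in a positive-index term of `theta y (y ^ 3)`. Triangular
  -- numbers of even index match the negative-index terms, so `psi` is the one-sided sum over all
  -- triangular numbers.
  triangular-odd : ∀ i → triangular (1 ℕ.+ i ℕ.* 2) ≡ triangular (suc i) ℕ.+ 3 ℕ.* triangular i
  triangular-odd zero    = ≡.refl
  triangular-odd (suc i) = ≡.trans (≡.cong (λ t → 3 ℕ.+ i ℕ.* 2 ℕ.+ (2 ℕ.+ i ℕ.* 2 ℕ.+ t)) (triangular-odd i))
    (identity i (triangular i))
    where
    identity : ∀ i t → 3 ℕ.+ i ℕ.* 2 ℕ.+ (2 ℕ.+ i ℕ.* 2 ℕ.+ (suc i ℕ.+ t ℕ.+ 3 ℕ.* t))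
                     ≡ suc (suc i) ℕ.+ (suc i ℕ.+ t) ℕ.+ 3 ℕ.* (suc i ℕ.+ t)
    identity = solve-∀

  triangular-even : ∀ i → triangular (2 ℕ.+ i ℕ.* 2) ≡ 3 ℕ.* triangular (suc i) ℕ.+ triangular i
  triangular-even i = ≡.trans (≡.cong (2 ℕ.+ i ℕ.* 2 ℕ.+_) (triangular-odd i)) (identity i (triangular i))
    where
    identity : ∀ i t → 2 ℕ.+ i ℕ.* 2 ℕ.+ (suc i ℕ.+ t ℕ.+ 3 ℕ.* t) ≡ 3 ℕ.* (suc i ℕ.+ t) ℕ.+ t
    identity = solve-∀

  -- This class of indices produces the summand `y * psi y ^ 9`. The other two classes give three
  -- times the exponents of the two halves of `theta y (y ^ 2)`, hence the cube.
  triangular-3k+1 : ∀ i → triangular (1 ℕ.+ i ℕ.* 3) ≡ 1 ℕ.+ triangular i ℕ.* 9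
  triangular-3k+1 zero    = ≡.refl
  triangular-3k+1 (suc i) = ≡.trans
    (≡.cong (λ t → 4 ℕ.+ i ℕ.* 3 ℕ.+ (3 ℕ.+ i ℕ.* 3 ℕ.+ (2 ℕ.+ i ℕ.* 3 ℕ.+ t))) (triangular-3k+1 i))
    (identity i (triangular i))
    where
    identity : ∀ i t → 4 ℕ.+ i ℕ.* 3 ℕ.+ (3 ℕ.+ i ℕ.* 3 ℕ.+ (2 ℕ.+ i ℕ.* 3 ℕ.+ (1 ℕ.+ t ℕ.* 9)))
                     ≡ 1 ℕ.+ (suc i ℕ.+ t) ℕ.* 9
    identity = solve-∀

  triangular-3k+2 : ∀ i → triangular (2 ℕ.+ i ℕ.* 3) ≡ (triangular (suc i) ℕ.+ 2 ℕ.* triangular i) ℕ.* 3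
  triangular-3k+2 i = ≡.trans (≡.cong (2 ℕ.+ i ℕ.* 3 ℕ.+_) (triangular-3k+1 i)) (identity i (triangular i))
    where
    identity : ∀ i t → 2 ℕ.+ i ℕ.* 3 ℕ.+ (1 ℕ.+ t ℕ.* 9) ≡ (suc i ℕ.+ t ℕ.+ 2 ℕ.* t) ℕ.* 3
    identity = solve-∀

  triangular-3k+3 : ∀ i → triangular (3 ℕ.+ i ℕ.* 3) ≡ (2 ℕ.* triangular (suc i) ℕ.+ triangular i) ℕ.* 3
  triangular-3k+3 i = ≡.trans (≡.cong (3 ℕ.+ i ℕ.* 3 ℕ.+_) (triangular-3k+2 i)) (identity i (triangular i))
    where
    identity : ∀ i t → 3 ℕ.+ i ℕ.* 3 ℕ.+ (suc i ℕ.+ t ℕ.+ 2 ℕ.* t) ℕ.* 3 ≡ (2 ℕ.* (suc i ℕ.+ t) ℕ.+ t) ℕ.* 3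
    identity = solve-∀

  triangular-square : ∀ k → triangular (suc k) ℕ.+ triangular k ≡ suc k ℕ.* suc k
  triangular-square zero    = ≡.refl
  triangular-square (suc k) = ≡.trans (identity₁ k (triangular k))
    (≡.trans (≡.cong (λ s → 3 ℕ.+ 2 ℕ.* k ℕ.+ s) (triangular-square k)) (identity₂ k))
    where
    identity₁ : ∀ k t → suc (suc k) ℕ.+ (suc k ℕ.+ t) ℕ.+ (suc k ℕ.+ t) ≡ 3 ℕ.+ 2 ℕ.* k ℕ.+ (suc k ℕ.+ t ℕ.+ t)
    identity₁ = solve-∀
    identity₂ : ∀ k → 3 ℕ.+ 2 ℕ.* k ℕ.+ suc k ℕ.* suc k ≡ suc (suc k) ℕ.* suc (suc k)
    identity₂ = solve-∀

-- The p-rings of McCoy and Montgomery for p = 3.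
record Is3Ring {c ℓ} (R : CommutativeRing c ℓ) : Set (c ⊔ ℓ) where
  open CommutativeRing R
  field
    1+1+1≈0 : 1# + 1# + 1# ≈ 0#
    x³≈x    : ∀ x → x * x * x ≈ x

module CharacteristicThree {c ℓ} (R : CommutativeRing c ℓ) (is3Ring : Is3Ring R) where
  private
    module K = CommutativeRing R

  open Is3Ring is3Ring
  open PowerSeries R
  open GaussianBinomial commutativeSemiring using (thetaTerm)
  open Theta R
  open SemiringSolver commutativeSemiring using (solve; _:=_; _:+_; _:*_; _:^_; con)
  open SetoidReasoning setoid

  thrice : ∀ f → f + f + f ≈ 0#
  thrice f = coeffwise λ n → K.trans
    (K.sym (K.trans (K.distribʳ (f n) _ _) (K.+-cong (K.trans (K.distribʳ (f n) _ _)
      (K.+-cong (K.*-identityˡ _) (K.*-identityˡ _))) (K.*-identityˡ _))))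
    (K.trans (K.*-congʳ 1+1+1≈0) (K.zeroˡ (f n)))

  double : ∀ f → f + f ≈ - f
  double f = begin
    f + f             ≈⟨ +-identityʳ (f + f) ⟨
    f + f + 0#        ≈⟨ +-congˡ (-‿inverseʳ f) ⟨
    f + f + (f + - f) ≈⟨ +-assoc (f + f) f (- f) ⟨
    f + f + f + - f   ≈⟨ +-congʳ (thrice f) ⟩
    0# + - f          ≈⟨ +-identityˡ (- f) ⟩
    - f               ∎

  cube-+ : ∀ f g → (f + g) ^ 3 ≈ f ^ 3 + g ^ 3
  cube-+ f g = begin
    (f + g) ^ 3
      ≈⟨ solve 2 (λ f g → (f :+ g) :^ 3 := f :^ 3 :+ g :^ 3
           :+ (f :* g :* (f :+ g) :+ f :* g :* (f :+ g) :+ f :* g :* (f :+ g))) refl f g ⟩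
    f ^ 3 + g ^ 3 + (f * g * (f + g) + f * g * (f + g) + f * g * (f + g))
      ≈⟨ +-congˡ (thrice (f * g * (f + g))) ⟩
    f ^ 3 + g ^ 3 + 0#
      ≈⟨ +-identityʳ _ ⟩
    f ^ 3 + g ^ 3 ∎

  ninth-+ : ∀ f g → (f + g) ^ 9 ≈ f ^ 9 + g ^ 9
  ninth-+ f g = begin
    (f + g) ^ 9             ≈⟨ ^-assocʳ (f + g) 3 3 ⟨
    ((f + g) ^ 3) ^ 3       ≈⟨ ^-congˡ 3 (cube-+ f g) ⟩
    (f ^ 3 + g ^ 3) ^ 3     ≈⟨ cube-+ (f ^ 3) (g ^ 3) ⟩
    (f ^ 3) ^ 3 + (g ^ 3) ^ 3 ≈⟨ +-cong (^-assocʳ f 3 3) (^-assocʳ g 3 3) ⟩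
    f ^ 9 + g ^ 9           ∎

  ^-cong[] : ∀ {N f g} k → f ≈[ N ] g → f ^ k ≈[ N ] g ^ k
  ^-cong[] zero    p = refl[]
  ^-cong[] (suc k) p = *-cong[] p (^-cong[] k p)

  ^-one : ∀ k → 1# ^ k ≈ 1#
  ^-one zero    = refl
  ^-one (suc k) = trans (*-identityˡ _) (^-one k)

  cube-Σ : ∀ {s} → Σ.Convergent s → Σ.fold∞ s ^ 3 ≈ Σ.fold∞ (λ i → s i ^ 3)
  cube-Σ = Σ.fold∞-hom (_^ 3) (^-cong[] 3) (zeroˡ _) cube-+

  ninth-Σ : ∀ {s} → Σ.Convergent s → Σ.fold∞ s ^ 9 ≈ Σ.fold∞ (λ i → s i ^ 9)
  ninth-Σ = Σ.fold∞-hom (_^ 9) (^-cong[] 9) (zeroˡ _) ninth-+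

  *-Σ : ∀ f {s} → Σ.Convergent s → f * Σ.fold∞ s ≈ Σ.fold∞ (λ i → f * s i)
  *-Σ f = Σ.fold∞-hom (f *_) (*-cong[] refl[]) (zeroʳ f) (distribˡ f)

  poch-cube : ∀ a {q} → NoConstant q → poch a q ^ 3 ≈ poch (a ^ 3) (q ^ 3)
  poch-cube a {q} q₀ = trans
    (Π.fold∞-hom (_^ 3) (^-cong[] 3) (^-one 3) (λ f g → ^-distrib-* f g 3) (poch-convergent a q₀))
    (Π.fold∞-cong λ i → begin
      (1# + a * q ^ i) ^ 3           ≈⟨ cube-+ 1# (a * q ^ i) ⟩
      1# ^ 3 + (a * q ^ i) ^ 3       ≈⟨ +-cong (^-one 3) (^-distrib-* a (q ^ i) 3) ⟩
      1# + a ^ 3 * (q ^ i) ^ 3       ≈⟨ +-congˡ (*-congˡ (trans (^-assocʳ q i 3)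
                                          (trans (^-congʳ q (ℕ.*-comm i 3)) (sym (^-assocʳ q 3 i))))) ⟩
      1# + a ^ 3 * (q ^ 3) ^ i       ∎)

  poch-neg-cube : ∀ a {q} → NoConstant q → poch (- a) q ^ 3 ≈ poch (- (a ^ 3)) (q ^ 3)
  poch-neg-cube a q₀ = trans (poch-cube (- a) q₀) (poch-cong (neg-cube a) refl)

  -- In `theta y (y ^ 2)` the factors `p₁` and `p₂` make up (-y;y)_∞ except for (-y³;y³)_∞, which
  -- modulo 3 is the cube of (-y;y)_∞. So they amount to (-y;y)_∞ to the power -2, which is
  -- (y;y²)_∞² by `euler`; with the one such factor in ψ(-y) a full cube arises.
  theta-psi : ∀ {y} → NoConstant y →
    theta y (y ^ 2) * psi (- y) ≈ poch (- (y ^ 4)) (y ^ 4) * phi (- y) ^ 3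
  theta-psi {y} y₀ = begin
    f * psi (- y)
      ≈⟨ *-cong f≈ (psi-neg-product y₀) ⟩
    e ^ 2 * (e * w) ^ 3 * (e * z)
      ≈⟨ solve 3 (λ e w z → e :^ 2 :* (e :* w) :^ 3 :* (e :* z) := z :* (e :* e :* w) :^ 3) refl e w z ⟩
    z * (e * e * w) ^ 3
      ≈⟨ *-congˡ (^-congˡ 3 (phi-neg-product y₀)) ⟨
    z * phi (- y) ^ 3 ∎
    where
    f e w z g p₁ p₂ : Series
    f = theta y (y ^ 2)
    e = poch (- y) (y ^ 2)
    w = poch (- (y ^ 2)) (y ^ 2)
    z = poch (- (y ^ 4)) (y ^ 4)
    g = poch y y
    p₁ = poch y (y ^ 3)
    p₂ = poch (y ^ 2) (y ^ 3)
    g-split : g ≈ p₁ * p₂ * g ^ 3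
    g-split = trans (poch-split₃ y y₀) (*-cong (*-congˡ (poch-cong (*-congˡ (sym (*-identityʳ y))) refl))
      (sym (poch-cube y y₀)))
    f-product : f ≈ p₁ * p₂ * (e * w) ^ 3
    f-product = trans (jacobiTripleProduct y₀ (noConstant-^suc 1 y₀))
      (*-congˡ (trans (sym (poch-neg-cube y y₀)) (^-congˡ 3 (poch-neg-split y₀))))
    f≈ : f ≈ e ^ 2 * (e * w) ^ 3
    f≈ = begin
      f
        ≈⟨ f-product ⟩
      p₁ * p₂ * (e * w) ^ 3
        -- Inserting (g e)³ = 1 provides the `g ^ 3` that completes `p₁ * p₂` to `g`.
        ≈⟨ trans (*-congˡ (trans (^-congˡ 3 (euler y₀)) (solve 0 (con 1 :^ 3 := con 1) refl))) (*-identityʳ _) ⟨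
      p₁ * p₂ * (e * w) ^ 3 * (g * e) ^ 3
        ≈⟨ solve 5 (λ p₁ p₂ e w g → p₁ :* p₂ :* (e :* w) :^ 3 :* (g :* e) :^ 3
             := p₁ :* p₂ :* g :^ 3 :* (e :^ 3 :* (e :* w) :^ 3)) refl p₁ p₂ e w g ⟩
      p₁ * p₂ * g ^ 3 * (e ^ 3 * (e * w) ^ 3)
        ≈⟨ *-congʳ g-split ⟨
      g * (e ^ 3 * (e * w) ^ 3)
        ≈⟨ solve 3 (λ g e w → g :* (e :^ 3 :* (e :* w) :^ 3) := g :* e :* (e :^ 2 :* (e :* w) :^ 3)) refl g e w ⟩
      g * e * (e ^ 2 * (e * w) ^ 3)
        ≈⟨ trans (*-congʳ (euler y₀)) (*-identityˡ _) ⟩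
      e ^ 2 * (e * w) ^ 3 ∎

  psi-sum : ∀ {y} → NoConstant y → psi y ≈ Σ.fold∞ (λ k → y ^ triangular k)
  psi-sum {y} y₀ = sym (begin
    Σ.fold∞ (λ k → y ^ triangular k)
      ≈⟨ Σ.fold∞-suc (powers-convergent y₀) ⟩
    1# + Σ.fold∞ (λ k → y ^ triangular (suc k))
      ≈⟨ +-congˡ (Σ.fold∞-blocks 2 (convergent-suc (powers-convergent y₀))) ⟩
    1# + Σ.fold∞ (λ i → y ^ triangular (1 ℕ.+ i ℕ.* 2) + (y ^ triangular (2 ℕ.+ i ℕ.* 2) + 0#))
      ≈⟨ +-congˡ (Σ.fold∞-cong λ i → +-cong (odd i) (trans (+-identityʳ _) (even i))) ⟩
    psi y ∎)
    where
    odd : ∀ i → y ^ triangular (1 ℕ.+ i ℕ.* 2) ≈ thetaTerm y (y ^ 3) i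
    odd i = trans (^-congʳ y (triangular-odd i)) (trans (^-homo-* y (triangular (suc i)) _)
      (*-congˡ (sym (^-assocʳ y 3 (triangular i)))))
    even : ∀ i → y ^ triangular (2 ℕ.+ i ℕ.* 2) ≈ thetaTerm (y ^ 3) y i
    even i = trans (^-congʳ y (triangular-even i)) (trans (^-homo-* y (3 ℕ.* triangular (suc i)) _)
      (*-congʳ (sym (^-assocʳ y 3 (triangular (suc i))))))

  psi-dissection : ∀ {y} → NoConstant y → psi y ≈ theta y (y ^ 2) ^ 3 + y * psi y ^ 9
  psi-dissection {y} y₀ = begin
    psi y
      ≈⟨ psi-sum y₀ ⟩
    Σ.fold∞ (λ k → y ^ triangular k)
      ≈⟨ Σ.fold∞-suc (powers-convergent y₀) ⟩
    1# + Σ.fold∞ (λ k → y ^ triangular (suc k))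
      ≈⟨ +-congˡ (Σ.fold∞-blocks 3 (convergent-suc (powers-convergent y₀))) ⟩
    1# + Σ.fold∞ (λ i → y ^ triangular (1 ℕ.+ i ℕ.* 3)
      + (y ^ triangular (2 ℕ.+ i ℕ.* 3) + (y ^ triangular (3 ℕ.+ i ℕ.* 3) + 0#)))
      ≈⟨ +-congˡ (Σ.fold∞-cong λ i → +-cong (one i) (trans (+-cong (two i) (trans (+-identityʳ _) (three i)))
           (sym (cube-+ (τ i) (τ′ i))))) ⟩
    1# + Σ.fold∞ (λ i → y * (y ^ triangular i) ^ 9 + (τ i + τ′ i) ^ 3)
      ≈⟨ +-congˡ (Σ.fold∞-∙ (λ i → *-zero[] y (convergent-^ 8 (powers-convergent y₀) i))
           (convergent-^ 2 τ-convergent)) ⟩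
    1# + (Σ.fold∞ (λ i → y * (y ^ triangular i) ^ 9) + Σ.fold∞ (λ i → (τ i + τ′ i) ^ 3))
      ≈⟨ +-congˡ (+-cong (sym (*-Σ y (convergent-^ 8 (powers-convergent y₀)))) (sym (cube-Σ τ-convergent))) ⟩
    1# + (y * Σ.fold∞ (λ i → (y ^ triangular i) ^ 9) + Σ.fold∞ (λ i → τ i + τ′ i) ^ 3)
      ≈⟨ +-congˡ (+-congʳ (*-congˡ (trans (sym (ninth-Σ (powers-convergent y₀))) (^-congˡ 9 (sym (psi-sum y₀)))))) ⟩
    1# + (y * psi y ^ 9 + Σ.fold∞ (λ i → τ i + τ′ i) ^ 3)
      ≈⟨ solve 2 (λ p s → con 1 :+ (p :+ s :^ 3) := con 1 :^ 3 :+ s :^ 3 :+ p) refl _ _ ⟩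
    1# ^ 3 + Σ.fold∞ (λ i → τ i + τ′ i) ^ 3 + y * psi y ^ 9
      ≈⟨ +-congʳ (cube-+ 1# _) ⟨
    theta y (y ^ 2) ^ 3 + y * psi y ^ 9 ∎
    where
    τ τ′ : ℕ → Series
    τ  = thetaTerm y (y ^ 2)
    τ′ = thetaTerm (y ^ 2) y
    τ-convergent : Σ.Convergent (λ i → τ i + τ′ i)
    τ-convergent i = +-zero[] (thetaTerm-convergent y₀ _ i) (thetaTerm-convergent (noConstant-^suc 1 y₀) _ i)
    one : ∀ i → y ^ triangular (1 ℕ.+ i ℕ.* 3) ≈ y * (y ^ triangular i) ^ 9
    one i = trans (^-congʳ y (triangular-3k+1 i)) (*-congˡ (sym (^-assocʳ y (triangular i) 9)))
    two : ∀ i → y ^ triangular (2 ℕ.+ i ℕ.* 3) ≈ τ i ^ 3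
    two i = trans (^-congʳ y (triangular-3k+2 i)) (trans (sym (^-assocʳ y (triangular (suc i) ℕ.+ 2 ℕ.* triangular i) 3)) (^-congˡ 3
      (trans (^-homo-* y (triangular (suc i)) (2 ℕ.* triangular i)) (*-congˡ (sym (^-assocʳ y 2 (triangular i)))))))
    three : ∀ i → y ^ triangular (3 ℕ.+ i ℕ.* 3) ≈ τ′ i ^ 3
    three i = trans (^-congʳ y (triangular-3k+3 i)) (trans (sym (^-assocʳ y (2 ℕ.* triangular (suc i) ℕ.+ triangular i) 3)) (^-congˡ 3
      (trans (^-homo-* y (2 ℕ.* triangular (suc i)) (triangular i)) (*-congʳ (sym (^-assocʳ y 2 (triangular (suc i))))))))

  -- Squares of multiples of 3 are nine times squares; all other squares are 1 modulo 3. The series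
  -- `g` stays existential because only the exponents it occupies matter later.
  phi-dissection : ∀ {y} → NoConstant y → Σ[ g ∈ Series ] phi y ≈ phi y ^ 9 + y * g ^ 3
  phi-dissection {y} y₀ = Σ.fold∞ h , (begin
    phi y
      ≈⟨ +-congˡ (Σ.fold∞-blocks 3 s-convergent) ⟩
    1# + Σ.fold∞ (λ i → s (i ℕ.* 3) + (s (1 ℕ.+ i ℕ.* 3) + (s (2 ℕ.+ i ℕ.* 3) + 0#)))
      ≈⟨ +-congˡ (Σ.fold∞-cong blocks) ⟩
    1# + Σ.fold∞ (λ i → s i ^ 9 + y * h i ^ 3)
      ≈⟨ +-congˡ (Σ.fold∞-∙ (convergent-^ 8 s-convergent) (λ i → *-zero[] y (convergent-^ 2 h-convergent i))) ⟩
    1# + (Σ.fold∞ (λ i → s i ^ 9) + Σ.fold∞ (λ i → y * h i ^ 3))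
      ≈⟨ +-congˡ (+-cong (sym (ninth-Σ s-convergent)) (sym (trans (*-congˡ (cube-Σ h-convergent))
           (*-Σ y (convergent-^ 2 h-convergent))))) ⟩
    1# + (Σ.fold∞ s ^ 9 + y * Σ.fold∞ h ^ 3)
      ≈⟨ +-assoc 1# _ _ ⟨
    1# + Σ.fold∞ s ^ 9 + y * Σ.fold∞ h ^ 3
      ≈⟨ +-congʳ (trans (+-congʳ (^-one 9)) refl) ⟨
    1# ^ 9 + Σ.fold∞ s ^ 9 + y * Σ.fold∞ h ^ 3
      ≈⟨ +-congʳ (ninth-+ 1# (Σ.fold∞ s)) ⟨
    phi y ^ 9 + y * Σ.fold∞ h ^ 3 ∎)
    where
    s h : ℕ → Series
    s k = thetaTerm y y k + thetaTerm y y k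
    h i = d i + d i
      where
      d : ℕ → Series
      -- The exponents are (k² - 1)/3 for k = 3i + 1 and k = 3i + 2; `h` doubles them to account for
      -- k and -k.
      d i = y ^ (i ℕ.* (2 ℕ.+ i ℕ.* 3)) + y ^ ((1 ℕ.+ i) ℕ.* (1 ℕ.+ i ℕ.* 3))
    s-convergent : Σ.Convergent s
    s-convergent k = +-zero[] (thetaTerm-convergent y₀ y k) (thetaTerm-convergent y₀ y k)
    h-convergent : Σ.Convergent h
    h-convergent i = +-zero[] d-small d-small
      where
      d-small : y ^ (i ℕ.* (2 ℕ.+ i ℕ.* 3)) + y ^ ((1 ℕ.+ i) ℕ.* (1 ℕ.+ i ℕ.* 3)) ≈[ i ] 0#
      d-small = +-zero[]
        (≈[]-weaken (ℕ.m≤m*n i (2 ℕ.+ i ℕ.* 3)) (noConstant-^ y₀ (i ℕ.* (2 ℕ.+ i ℕ.* 3))))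
        (≈[]-weaken (ℕ.≤-trans (ℕ.n≤1+n i) (ℕ.m≤m*n (1 ℕ.+ i) (1 ℕ.+ i ℕ.* 3)))
          (noConstant-^ y₀ ((1 ℕ.+ i) ℕ.* (1 ℕ.+ i ℕ.* 3))))
    square : ∀ k → thetaTerm y y k ≈ y ^ (suc k ℕ.* suc k)
    square k = trans (sym (^-homo-* y (triangular (suc k)) (triangular k))) (^-congʳ y (triangular-square k))
    one : ∀ i → thetaTerm y y (i ℕ.* 3) ≈ y * (y ^ (i ℕ.* (2 ℕ.+ i ℕ.* 3))) ^ 3
    one i = trans (square (i ℕ.* 3)) (trans (^-congʳ y (exponent i))
      (*-congˡ (sym (^-assocʳ y (i ℕ.* (2 ℕ.+ i ℕ.* 3)) 3))))
      where
      exponent : ∀ i → suc (i ℕ.* 3) ℕ.* suc (i ℕ.* 3) ≡ 1 ℕ.+ i ℕ.* (2 ℕ.+ i ℕ.* 3) ℕ.* 3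
      exponent = solve-∀
    two : ∀ i → thetaTerm y y (1 ℕ.+ i ℕ.* 3) ≈ y * (y ^ ((1 ℕ.+ i) ℕ.* (1 ℕ.+ i ℕ.* 3))) ^ 3
    two i = trans (square (1 ℕ.+ i ℕ.* 3)) (trans (^-congʳ y (exponent i))
      (*-congˡ (sym (^-assocʳ y ((1 ℕ.+ i) ℕ.* (1 ℕ.+ i ℕ.* 3)) 3))))
      where
      exponent : ∀ i → (2 ℕ.+ i ℕ.* 3) ℕ.* (2 ℕ.+ i ℕ.* 3) ≡ 1 ℕ.+ (1 ℕ.+ i) ℕ.* (1 ℕ.+ i ℕ.* 3) ℕ.* 3
      exponent = solve-∀
    three : ∀ i → thetaTerm y y (2 ℕ.+ i ℕ.* 3) ≈ thetaTerm y y i ^ 9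
    three i = trans (square (2 ℕ.+ i ℕ.* 3)) (trans (^-congʳ y (exponent i))
      (trans (sym (^-assocʳ y (suc i ℕ.* suc i) 9)) (^-congˡ 9 (sym (square i)))))
      where
      exponent : ∀ i → (3 ℕ.+ i ℕ.* 3) ℕ.* (3 ℕ.+ i ℕ.* 3) ≡ (suc i ℕ.* suc i) ℕ.* 9
      exponent = solve-∀
    blocks : ∀ i → s (i ℕ.* 3) + (s (1 ℕ.+ i ℕ.* 3) + (s (2 ℕ.+ i ℕ.* 3) + 0#)) ≈ s i ^ 9 + y * h i ^ 3
    blocks i = begin
      s (i ℕ.* 3) + (s (1 ℕ.+ i ℕ.* 3) + (s (2 ℕ.+ i ℕ.* 3) + 0#))
        ≈⟨ +-cong (+-cong (one i) (one i)) (+-cong (+-cong (two i) (two i))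
             (trans (+-identityʳ _) (+-cong (three i) (three i)))) ⟩
      (y * u ^ 3 + y * u ^ 3) + ((y * v ^ 3 + y * v ^ 3) + (t ^ 9 + t ^ 9))
        ≈⟨ solve 4 (λ y u v t → (y :* u :+ y :* u) :+ ((y :* v :+ y :* v) :+ (t :+ t))
             := (t :+ t) :+ y :* ((u :+ v) :+ (u :+ v))) refl y (u ^ 3) (v ^ 3) (t ^ 9) ⟩
      (t ^ 9 + t ^ 9) + y * ((u ^ 3 + v ^ 3) + (u ^ 3 + v ^ 3))
        ≈⟨ +-cong (ninth-+ t t) (*-congˡ (trans (cube-+ (u + v) (u + v)) (+-cong (cube-+ u v) (cube-+ u v)))) ⟨
      s i ^ 9 + y * h i ^ 3 ∎
      where
      t u v : Series
      t = thetaTerm y y i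
      u = y ^ (i ℕ.* (2 ℕ.+ i ℕ.* 3))
      v = y ^ ((1 ℕ.+ i) ℕ.* (1 ℕ.+ i ℕ.* 3))

  -- f(X³)
  inflate : Series → Series
  inflate f zero                = f 0
  inflate f (suc zero)          = K.0#
  inflate f (suc (suc zero))    = K.0#
  inflate f (suc (suc (suc n))) = inflate (f ∘ suc) n

  private
    constant : K.Carrier → Series
    constant x zero    = x
    constant x (suc _) = K.0#

    decompose : ∀ f → f ≈ constant (f 0) + X * (f ∘ suc)
    decompose f = coeffwise λ
      { zero    → K.sym (K.trans (K.+-congˡ (K.zeroˡ _)) (K.+-identityʳ _))
      ; (suc n) → K.sym (K.trans (K.+-congˡ (X*-suc (f ∘ suc) n)) (K.+-identityˡ _)) }

    constant-* : ∀ x f n → (constant x * f) n K.≈ x K.* f n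
    constant-* x f zero    = K.refl
    constant-* x f (suc n) = K.trans (K.+-congˡ (coeff (zeroˡ f) n)) (K.+-identityʳ _)

    constant-cube : ∀ x → constant x ^ 3 ≈ constant x
    constant-cube x = coeffwise λ n → K.trans (constant-* x _ n) (K.trans (K.*-congˡ (constant-* x _ n))
      (K.trans (K.*-congˡ (K.*-congˡ (coeff (*-identityʳ (constant x)) n))) (collapse n)))
      where
      collapse : ∀ n → x K.* (x K.* constant x n) K.≈ constant x n
      collapse zero    = K.trans (K.sym (K.*-assoc x x x)) (x³≈x x)
      collapse (suc n) = K.trans (K.*-congˡ (K.zeroʳ x)) (K.zeroʳ x)

    cube-decompose : ∀ f → f ^ 3 ≈ constant (f 0) + X * (X * (X * (f ∘ suc) ^ 3))
    cube-decompose f = begin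
      f ^ 3
        ≈⟨ ^-congˡ 3 (decompose f) ⟩
      (constant (f 0) + X * (f ∘ suc)) ^ 3
        ≈⟨ cube-+ (constant (f 0)) (X * (f ∘ suc)) ⟩
      constant (f 0) ^ 3 + (X * (f ∘ suc)) ^ 3
        ≈⟨ +-cong (constant-cube (f 0)) (solve 2 (λ x t → (x :* t) :^ 3 := x :* (x :* (x :* t :^ 3))) refl X (f ∘ suc)) ⟩
      constant (f 0) + X * (X * (X * (f ∘ suc) ^ 3)) ∎

    X*-zero : ∀ f → (X * f) 0 K.≈ K.0#
    X*-zero f = K.zeroˡ (f 0)

  -- Frobenius for series. Additivity of cubing splits f₀ + X f₁, the law x³ = x preserves the
  -- constant f₀, and the argument repeats on f₁ three degrees higher.
  cube≈inflate : ∀ f → f ^ 3 ≈ inflate f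
  cube≈inflate f = coeffwise (at f)
    where
    at : ∀ f n → (f ^ 3) n K.≈ inflate f n
    at f zero = K.trans (coeff (cube-decompose f) 0)
      (K.trans (K.+-congˡ (X*-zero (X * (X * (f ∘ suc) ^ 3)))) (K.+-identityʳ _))
    at f (suc zero) = K.trans (coeff (cube-decompose f) 1) (K.trans (K.+-congˡ
      (K.trans (X*-suc (X * (X * (f ∘ suc) ^ 3)) 0) (X*-zero (X * (f ∘ suc) ^ 3)))) (K.+-identityʳ _))
    at f (suc (suc zero)) = K.trans (coeff (cube-decompose f) 2) (K.trans (K.+-congˡ
      (K.trans (X*-suc (X * (X * (f ∘ suc) ^ 3)) 1) (K.trans (X*-suc (X * (f ∘ suc) ^ 3) 0)
        (X*-zero ((f ∘ suc) ^ 3))))) (K.+-identityʳ _))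
    at f (suc (suc (suc n))) = K.trans (coeff (cube-decompose f) (3 ℕ.+ n)) (K.trans (K.+-identityˡ _)
      (K.trans (X*-suc (X * (X * (f ∘ suc) ^ 3)) (2 ℕ.+ n)) (K.trans (X*-suc (X * (f ∘ suc) ^ 3) (1 ℕ.+ n))
        (K.trans (X*-suc ((f ∘ suc) ^ 3) n) (at (f ∘ suc) n)))))

  -- Exponents in a residue class modulo 3

  section : ℕ → Series → Series
  section r f n = f (n ℕ.* 3 ℕ.+ r)

  section-cong : ∀ r {f g} → f ≈ g → section r f ≈ section r g
  section-cong r p = coeffwise λ n → coeff p (n ℕ.* 3 ℕ.+ r)

  section-inflate-* : ∀ {r} → r ℕ.< 3 → ∀ g f → section r (inflate g * f) ≈ g * section r f
  section-inflate-* {r} r<3 g f = coeffwise (at g)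
    where
    base : ∀ r → r ℕ.< 3 → ∀ g → (inflate g * f) r K.≈ g 0 K.* f r
    base 0 _ g = K.refl
    base 1 _ g = K.trans (K.+-congˡ (K.zeroˡ _)) (K.+-identityʳ _)
    base 2 _ g = K.trans (K.+-congˡ (K.trans (K.+-cong (K.zeroˡ _) (K.zeroˡ _)) (K.+-identityʳ _))) (K.+-identityʳ _)
    base (suc (suc (suc _))) (s≤s (s≤s (s≤s ()))) g
    at : ∀ g n → section r (inflate g * f) n K.≈ (g * section r f) n
    at g zero    = base r r<3 g
    at g (suc n) = K.+-congˡ (K.trans (K.+-cong (K.zeroˡ _) (K.trans (K.+-congʳ (K.zeroˡ _)) (K.+-identityˡ _)))
      (K.trans (K.+-identityˡ _) (at (g ∘ suc) n)))

  -- A cube has exponents divisible by 3 only, so it does not mix classes, and renumbering the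
  -- exponents undoes the cubing.
  section-cube-* : ∀ {r} → r ℕ.< 3 → ∀ g f → section r (g ^ 3 * f) ≈ g * section r f
  section-cube-* r<3 g f = trans (section-cong _ (*-congʳ (cube≈inflate g))) (section-inflate-* r<3 g f)

  -- With components given as cubes, the sections come out as `a`, `b`, `c` themselves. The factor
  -- `1#` lets `section-cube-*` treat all three summands alike.
  module Dissection {f a b c : Series} (p : f ≈ a ^ 3 * 1# + b ^ 3 * X + c ^ 3 * X ^ 2) where
    private
      sections : ∀ {r} → r ℕ.< 3 →
        section r f ≈ a * section r 1# + b * section r X + c * section r (X ^ 2)
      sections r<3 = trans (section-cong _ p)
        (+-cong (+-cong (section-cube-* r<3 a 1#) (section-cube-* r<3 b X)) (section-cube-* r<3 c (X ^ 2)))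

      X²-suc : ∀ n → (X ^ 2) (suc n) K.≈ X n
      X²-suc n = K.trans (X*-suc (X ^ 1) n) (coeff (*-identityʳ X) n)

      pick : ∀ {r x y z} → r ℕ.< 3 → section r 1# ≈ x → section r X ≈ y → section r (X ^ 2) ≈ z →
        section r f ≈ a * x + b * y + c * z
      pick r<3 p q s = trans (sections r<3) (+-cong (+-cong (*-congˡ p) (*-congˡ q)) (*-congˡ s))

    section₀ : section 0 f ≈ a
    section₀ = trans
      (pick {0} {1#} {0#} {0#} ℕ.z<s
        (coeffwise λ { zero → K.refl ; (suc n) → K.refl })
        (coeffwise λ { zero → K.refl ; (suc n) → K.refl })
        (coeffwise λ { zero → X*-zero (X ^ 1) ; (suc n) → X²-suc (2 ℕ.+ (n ℕ.* 3 ℕ.+ 0)) }))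
      (solve 3 (λ a b c → a :* con 1 :+ b :* con 0 :+ c :* con 0 := a) refl a b c)

    section₁ : section 1 f ≈ b
    section₁ = trans
      (pick {1} {0#} {1#} {0#} (s≤s ℕ.z<s)
        (coeffwise λ { zero → K.refl ; (suc n) → K.refl })
        (coeffwise λ { zero → K.refl ; (suc n) → K.refl })
        (coeffwise λ { zero → X²-suc 0 ; (suc n) → X²-suc (2 ℕ.+ (n ℕ.* 3 ℕ.+ 1)) }))
      (solve 3 (λ a b c → a :* con 0 :+ b :* con 1 :+ c :* con 0 := b) refl a b c)

    section₂ : section 2 f ≈ c
    section₂ = trans
      (pick {2} {0#} {0#} {1#} (s≤s (s≤s ℕ.z<s))
        (coeffwise λ { zero → K.refl ; (suc n) → K.refl })
        (coeffwise λ { zero → K.refl ; (suc n) → K.refl })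
        (coeffwise λ { zero → X²-suc 1
          ; (suc n) → K.trans (X²-suc (2 ℕ.+ (n ℕ.* 3 ℕ.+ 2))) (K.reflexive (≡.cong (λ m → 1# (suc m)) (ℕ.+-suc (n ℕ.* 3) 1))) }))
      (solve 3 (λ a b c → a :* con 0 :+ b :* con 0 :+ c :* con 1 := c) refl a b c)

  -- The square of `psi-dissection`. The cross term keeps `y + y`, which is simplified differently
  -- at y = X and at y = -X.
  psi-square : ∀ {y} → NoConstant y → psi y ^ 2 ≈
    (theta y (y ^ 2) ^ 2) ^ 3 * 1# + (theta y (y ^ 2) * psi y ^ 3) ^ 3 * (y + y) + (psi y ^ 6) ^ 3 * y ^ 2
  psi-square {y} y₀ = trans (^-congˡ 2 (psi-dissection y₀)) (trans
    (solve 3 (λ a y t → (a :+ y :* t) :^ 2 := a :* a :* con 1 :+ a :* t :* (y :+ y) :+ t :* t :* y :^ 2)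
      refl (A ^ 3) y (S ^ 9))
    (+-cong (+-cong (*-congʳ (trans (sym (^-homo-* A 3 3)) (sym (^-assocʳ A 2 3))))
                    (*-congʳ (trans (*-congˡ (sym (^-assocʳ S 3 3))) (sym (^-distrib-* A (S ^ 3) 3)))))
            (*-congʳ (trans (sym (^-homo-* S 9 9)) (sym (^-assocʳ S 6 3))))))
    where
    A S : Series
    A = theta y (y ^ 2)
    S = psi y

  -- Sections of the generating function

  module _ {D : Series}
    (D-product : D * (poch (- X) (X ^ 6) * poch (- (X ^ 5)) (X ^ 6) * poch (- (X ^ 4)) (X ^ 4)) ≈ 1#) where

    private
      z : Series
      z = poch (- (X ^ 4)) (X ^ 4)

      z-unit : Unit z
      z-unit = poch-unit (noConstant-neg (noConstant-^suc 3 noConstant-X)) (noConstant-^suc 3 noConstant-X)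

      -X₀ : NoConstant (- X)
      -X₀ = noConstant-neg noConstant-X

      -- The product ψ(-X) = (X;X²)_∞ `z` contains the whole denominator of `D`; what is left over
      -- is class 3 modulo 6, that is (X³;X⁶)_∞, which modulo 3 is a cube.
      D-psi : D * psi (- X) ≈ poch (- X) (X ^ 2) ^ 3
      D-psi = begin
        D * psi (- X)
          ≈⟨ *-congˡ (trans (psi-neg-product noConstant-X) (*-congʳ split)) ⟩
        D * (p₁ * poch (- X) (X ^ 2) ^ 3 * p₅ * z)
          ≈⟨ solve 5 (λ d p₁ e p₅ z → d :* (p₁ :* e :* p₅ :* z) := d :* (p₁ :* p₅ :* z) :* e) refl D p₁ _ p₅ z ⟩
        D * (p₁ * p₅ * z) * poch (- X) (X ^ 2) ^ 3
          ≈⟨ trans (*-congʳ D-product) (*-identityˡ _) ⟩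
        poch (- X) (X ^ 2) ^ 3 ∎
        where
        p₁ p₅ : Series
        p₁ = poch (- X) (X ^ 6)
        p₅ = poch (- (X ^ 5)) (X ^ 6)
        split : poch (- X) (X ^ 2) ≈ p₁ * poch (- X) (X ^ 2) ^ 3 * p₅
        split = trans (poch-split₃ (- X) (noConstant-^suc 1 noConstant-X))
          (*-cong (*-cong (poch-cong refl (^-assocʳ X 2 3))
                          (trans (poch-cong (sym (-‿distribˡ-* X (X ^ 2))) refl)
                                 (sym (poch-neg-cube X (noConstant-^suc 1 noConstant-X)))))
                  (poch-cong (trans (*-congˡ (^-assocʳ X 2 2)) (sym (-‿distribˡ-* X (X ^ 4)))) (^-assocʳ X 2 3)))

      D-square : z ^ 3 * D ≈ psi (- X) ^ 2
      D-square = unit-cancel (psi-unit -X₀) (begin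
        psi (- X) * (z ^ 3 * D)        ≈⟨ solve 3 (λ s z d → s :* (z :* d) := d :* s :* z) refl (psi (- X)) (z ^ 3) D ⟩
        D * psi (- X) * z ^ 3          ≈⟨ *-congʳ D-psi ⟩
        poch (- X) (X ^ 2) ^ 3 * z ^ 3 ≈⟨ ^-distrib-* (poch (- X) (X ^ 2)) z 3 ⟨
        (poch (- X) (X ^ 2) * z) ^ 3   ≈⟨ ^-congˡ 3 (psi-neg-product noConstant-X) ⟨
        psi (- X) ^ 3                  ∎)

      A : Series
      A = theta (- X) ((- X) ^ 2)

      -X-dissection : psi (- X) ^ 2 ≈
        (A ^ 2) ^ 3 * 1# + (A * psi (- X) ^ 3) ^ 3 * X + (psi (- X) ^ 6) ^ 3 * X ^ 2
      -X-dissection = trans (psi-square -X₀)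
        -- The cross term carries 2(-X), which is X modulo 3, so the middle component needs no sign.
        (+-cong (+-congˡ (*-congˡ (trans (double (- X)) (-‿involutive X)))) (*-congˡ (neg-square X)))

      z-section : z * section 1 D ≈ A * psi (- X) ^ 3
      z-section = trans (sym (section-cube-* (s≤s ℕ.z<s) z D))
        (trans (section-cong 1 D-square) (Dissection.section₁ -X-dissection))

      A-psi : A * psi X ≈ z * phi X ^ 3
      A-psi = trans (*-congˡ (theta-cong (sym (-‿involutive X)) (^-congˡ 3 (sym (-‿involutive X)))))
        (trans (theta-psi -X₀) (*-cong (poch-cong (-‿cong (neg-fourth X)) (neg-fourth X))
          (^-congˡ 3 (theta-cong (-‿involutive X) (-‿involutive X)))))

      phi-psi-X : phi X * psi (- X) ≈ psi X * phi (- (X ^ 2))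
      phi-psi-X = trans (*-congʳ (theta-cong (sym (-‿involutive X)) (sym (-‿involutive X))))
        (trans (phi-psi -X₀) (*-cong (theta-cong (-‿involutive X) (^-congˡ 3 (-‿involutive X)))
          (theta-cong (-‿cong (neg-square X)) (-‿cong (neg-square X)))))

      Φ : Series
      Φ = phi (- (X ^ 2))

    -- The extra factor ψ(X) makes `A-psi` applicable; its φ(X)³ joins ψ(-X)³ into the cube of the
    -- left side of `phi-psi-X`. One of the resulting three factors ψ(X) then cancels together with
    -- `z`.
    section₁-theta : section 1 D ≈ Φ ^ 3 * psi X ^ 2
    section₁-theta = unit-cancel (*-one[] z-unit (psi-unit noConstant-X)) (begin
      z * psi X * section 1 D
        ≈⟨ solve 3 (λ z s d → z :* s :* d := z :* d :* s) refl z (psi X) (section 1 D) ⟩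
      z * section 1 D * psi X
        ≈⟨ *-congʳ z-section ⟩
      A * psi (- X) ^ 3 * psi X
        ≈⟨ solve 3 (λ a t s → a :* t :* s := a :* s :* t) refl A (psi (- X) ^ 3) (psi X) ⟩
      A * psi X * psi (- X) ^ 3
        ≈⟨ *-congʳ A-psi ⟩
      z * phi X ^ 3 * psi (- X) ^ 3
        ≈⟨ trans (*-assoc z _ _) (*-congˡ (sym (^-distrib-* (phi X) (psi (- X)) 3))) ⟩
      z * (phi X * psi (- X)) ^ 3
        ≈⟨ *-congˡ (^-congˡ 3 phi-psi-X) ⟩
      z * (psi X * Φ) ^ 3
        ≈⟨ *-congˡ (^-distrib-* (psi X) Φ 3) ⟩
      z * (psi X ^ 3 * Φ ^ 3)
        ≈⟨ solve 4 (λ z s s² f → z :* (s :* s² :* f) := z :* s :* (f :* s²)) refl z (psi X) (psi X ^ 2) (Φ ^ 3) ⟩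
      z * psi X * (Φ ^ 3 * psi X ^ 2) ∎)

    private
      section₂₁-theta : section 2 (section 1 D) ≈ (psi X ^ 2) ^ 3 * Φ
      section₂₁-theta = begin
        section 2 (section 1 D)        ≈⟨ section-cong 2 section₁-theta ⟩
        section 2 (Φ ^ 3 * psi X ^ 2)  ≈⟨ section-cube-* ℕ.≤-refl Φ (psi X ^ 2) ⟩
        Φ * section 2 (psi X ^ 2)      ≈⟨ *-congˡ (Dissection.section₂ X-dissection) ⟩
        Φ * psi X ^ 6                  ≈⟨ trans (*-comm _ _) (*-congʳ (sym (^-assocʳ (psi X) 2 3))) ⟩
        (psi X ^ 2) ^ 3 * Φ            ∎
        where
        B : Series
        B = theta X (X ^ 2) * psi X ^ 3
        X-dissection : psi X ^ 2 ≈ (theta X (X ^ 2) ^ 2) ^ 3 * 1# + (B + B) ^ 3 * X + (psi X ^ 6) ^ 3 * X ^ 2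
        X-dissection = trans (psi-square noConstant-X) (+-congʳ (+-congˡ (trans
          (trans (distribˡ (B ^ 3) X X) (sym (distribʳ X (B ^ 3) (B ^ 3)))) (*-congʳ (sym (cube-+ B B))))))

      -- At y = -X² the second summand of `phi-dissection` lies in class 2, its sign absorbed into
      -- the cube. The empty slot at X yields the vanishing, and the component `Φ ^ 3` in class 0
      -- yields the periodicity.
      Φ-dissection : Σ[ g ∈ Series ] Φ ≈ (Φ ^ 3) ^ 3 * 1# + 0# ^ 3 * X + g ^ 3 * X ^ 2
      Φ-dissection = let g , p = phi-dissection (noConstant-neg (noConstant-^suc 1 noConstant-X)) in - g , (begin
        Φ                                                   ≈⟨ p ⟩
        Φ ^ 9 + - (X ^ 2) * g ^ 3
          ≈⟨ +-cong (sym (^-assocʳ Φ 3 3)) (trans (*-comm _ _) (trans (sym (-‿distribʳ-* (g ^ 3) (X ^ 2)))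
               (trans (-‿distribˡ-* (g ^ 3) (X ^ 2)) (*-congʳ (sym (neg-cube g)))))) ⟩
        (Φ ^ 3) ^ 3 + (- g) ^ 3 * X ^ 2
          ≈⟨ solve 3 (λ f x t → f :+ t := f :* con 1 :+ con 0 :^ 3 :* x :+ t) refl ((Φ ^ 3) ^ 3) X ((- g) ^ 3 * X ^ 2) ⟩
        (Φ ^ 3) ^ 3 * 1# + 0# ^ 3 * X + (- g) ^ 3 * X ^ 2 ∎)

    section₁₂₁-vanishes : section 1 (section 2 (section 1 D)) ≈ 0#
    section₁₂₁-vanishes = let _ , p = Φ-dissection in begin
      section 1 (section 2 (section 1 D)) ≈⟨ section-cong 1 section₂₁-theta ⟩
      section 1 ((psi X ^ 2) ^ 3 * Φ)     ≈⟨ section-cube-* (s≤s ℕ.z<s) (psi X ^ 2) Φ ⟩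
      psi X ^ 2 * section 1 Φ             ≈⟨ *-congˡ (Dissection.section₁ p) ⟩
      psi X ^ 2 * 0#                      ≈⟨ zeroʳ _ ⟩
      0#                                  ∎

    section₀₂₁-periodic : section 0 (section 2 (section 1 D)) ≈ section 1 D
    section₀₂₁-periodic = let _ , p = Φ-dissection in begin
      section 0 (section 2 (section 1 D)) ≈⟨ section-cong 0 section₂₁-theta ⟩
      section 0 ((psi X ^ 2) ^ 3 * Φ)     ≈⟨ section-cube-* ℕ.z<s (psi X ^ 2) Φ ⟩
      psi X ^ 2 * section 0 Φ             ≈⟨ *-congˡ (Dissection.section₀ p) ⟩
      psi X ^ 2 * Φ ^ 3                   ≈⟨ *-comm _ _ ⟩
      Φ ^ 3 * psi X ^ 2                   ≈⟨ section₁-theta ⟨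
      section 1 D                         ∎

-- ℤ/(d+1), carried by ℕ.
moduloRing : ℕ → CommutativeRing _ _
moduloRing d = record
  { Carrier = ℕ
  ; _≈_ = λ x y → x % suc d ≡ y % suc d
  ; _+_ = ℕ._+_
  ; _*_ = ℕ._*_
  ; -_  = d ℕ.*_
  ; 0#  = 0
  ; 1#  = 1
  ; isCommutativeRing = record
    { isRing = record
      { +-isAbelianGroup = record
        { isGroup = record
          { isMonoid = record
            { isSemigroup = record
              { isMagma = record
                { isEquivalence = record { refl = ≡.refl ; sym = ≡.sym ; trans = ≡.trans }
                ; ∙-cong = λ {x y u v} → +-cong x y u v
                }
              ; assoc = λ x y z → ≡.cong (_% suc d) (ℕ.+-assoc x y z)
              }
            ; identity = (λ _ → ≡.refl) , (λ x → ≡.cong (_% suc d) (ℕ.+-identityʳ x))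
            }
          ; inverse = (λ x → ≡.trans (≡.cong (_% suc d) (ℕ.+-comm (d ℕ.* x) x)) (inverse x)) , inverse
          ; ⁻¹-cong = λ {x y} → *-cong d d x y ≡.refl
          }
        ; comm = λ x y → ≡.cong (_% suc d) (ℕ.+-comm x y)
        }
      ; *-cong = λ {x y u v} → *-cong x y u v
      ; *-assoc = λ x y z → ≡.cong (_% suc d) (ℕ.*-assoc x y z)
      ; *-identity = (λ x → ≡.cong (_% suc d) (ℕ.*-identityˡ x)) , (λ x → ≡.cong (_% suc d) (ℕ.*-identityʳ x))
      ; distrib = (λ x y z → ≡.cong (_% suc d) (ℕ.*-distribˡ-+ x y z))
                , (λ x y z → ≡.cong (_% suc d) (ℕ.*-distribʳ-+ x y z))
      }
    ; *-comm = λ x y → ≡.cong (_% suc d) (ℕ.*-comm x y)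
    }
  }
  where
  +-cong : ∀ x y u v → x % suc d ≡ y % suc d → u % suc d ≡ v % suc d → (x ℕ.+ u) % suc d ≡ (y ℕ.+ v) % suc d
  +-cong x y u v p q = ≡.trans (%-distribˡ-+ x u (suc d)) (≡.trans
    (≡.cong₂ (λ a b → (a ℕ.+ b) % suc d) p q) (≡.sym (%-distribˡ-+ y v (suc d))))
  *-cong : ∀ x y u v → x % suc d ≡ y % suc d → u % suc d ≡ v % suc d → (x ℕ.* u) % suc d ≡ (y ℕ.* v) % suc d
  *-cong x y u v p q = ≡.trans (%-distribˡ-* x u (suc d)) (≡.trans
    (≡.cong₂ (λ a b → (a ℕ.* b) % suc d) p q) (≡.sym (%-distribˡ-* y v (suc d))))
  inverse : ∀ x → (x ℕ.+ d ℕ.* x) % suc d ≡ 0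
  inverse x = ≡.trans (≡.cong (_% suc d) (ℕ.*-comm (suc d) x)) (m*n%n≡0 x (suc d))

cube-modulo-3 : ∀ x → (x ℕ.* x ℕ.* x) % 3 ≡ x % 3
cube-modulo-3 zero    = ≡.refl
cube-modulo-3 (suc x) = ≡.trans (≡.cong (_% 3) (expand x)) (≡.trans
  ([m+kn]%n≡m%n (1 ℕ.+ x ℕ.* x ℕ.* x) (x ℕ.* x ℕ.+ x) 3)
  (CommutativeRing.+-cong (moduloRing 2) {1} {1} {x ℕ.* x ℕ.* x} {x} ≡.refl (cube-modulo-3 x)))
  where
  expand : ∀ x → suc x ℕ.* suc x ℕ.* suc x ≡ 1 ℕ.+ x ℕ.* x ℕ.* x ℕ.+ (x ℕ.* x ℕ.+ x) ℕ.* 3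
  expand = solve-∀

-- The generating function of dp

countBounded : (ℓ k n : ℕ) → ℕ
countBounded ℓ k n = length (filter (all? admissible?) (boundedPartitions ℓ k n))

private
  length-filter-map : ∀ x xss → length (filter (all? admissible?) (map (x ∷_) xss))
    ≡ (if does (admissible? x) then length (filter (all? admissible?) xss) else 0)
  length-filter-map x [] with does (admissible? x)
  ... | true  = ≡.refl
  ... | false = ≡.refl
  length-filter-map x (xs ∷ xss) with does (admissible? x) | length-filter-map x xss
  ... | false | ih = ih
  ... | true  | ih with does (all? admissible? xs)
  ...   | true  = ≡.cong suc ih
  ...   | false = ih

countBounded-zero : ∀ ℓ k → countBounded ℓ k 0 ≡ 1
countBounded-zero zero    k = ≡.refl
countBounded-zero (suc ℓ) k = ≡.refl

countBounded-small : ∀ ℓ {k n} → n ℕ.< k → countBounded (suc ℓ) (suc k) (suc n) ≡ countBounded (suc ℓ) k (suc n)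
countBounded-small ℓ {k} {n} n<k with k ℕ.≤? n
... | yes k≤n = contradiction k≤n (ℕ.<⇒≱ n<k)
... | no  _   = ≡.refl

countBounded-suc : ∀ ℓ {k n} → k ℕ.≤ n → countBounded (suc ℓ) (suc k) (suc n) ≡
  countBounded (suc ℓ) k (suc n) ℕ.+ (if does (admissible? (suc k)) then countBounded ℓ (suc k) (n ℕ.∸ k) else 0)
countBounded-suc ℓ {k} {n} k≤n with k ℕ.≤? n
... | no  k≰n = contradiction k≤n k≰n
... | yes _   = ≡.trans
  (≡.cong length (filter-++ (all? admissible?) (boundedPartitions (suc ℓ) k (suc n)) _))
  (≡.trans (length-++ (filter (all? admissible?) (boundedPartitions (suc ℓ) k (suc n))))
    (≡.cong (countBounded (suc ℓ) k (suc n) ℕ.+_) (length-filter-map (suc k) (boundedPartitions ℓ (suc k) (n ℕ.∸ k)))))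

-- Removing a part lowers the length bound by one but the total by the whole part, so the bound
-- drifts away from the total. This restores the pairing ℓ = n used by `boundedSeries`.
countBounded-stable : ∀ ℓ ℓ′ k {n} → n ℕ.≤ ℓ → n ℕ.≤ ℓ′ → countBounded ℓ k n ≡ countBounded ℓ′ k n
countBounded-stable ℓ ℓ′ k {zero} _ _ = ≡.trans (countBounded-zero ℓ k) (≡.sym (countBounded-zero ℓ′ k))
countBounded-stable (suc ℓ) (suc ℓ′) zero {suc n} _ _ = ≡.refl
countBounded-stable (suc ℓ) (suc ℓ′) (suc k) {suc n} (s≤s p) (s≤s q) with ℕ.≤-<-connex k n
... | inj₂ n<k = ≡.trans (countBounded-small ℓ n<k)
  (≡.trans (countBounded-stable (suc ℓ) (suc ℓ′) k (s≤s p) (s≤s q)) (≡.sym (countBounded-small ℓ′ n<k)))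
... | inj₁ k≤n = ≡.trans (countBounded-suc ℓ k≤n) (≡.trans
  (≡.cong₂ (λ x y → x ℕ.+ (if does (admissible? (suc k)) then y else 0))
    (countBounded-stable (suc ℓ) (suc ℓ′) k (s≤s p) (s≤s q))
    (countBounded-stable ℓ ℓ′ (suc k) (ℕ.≤-trans (ℕ.m∸n≤m n k) p) (ℕ.≤-trans (ℕ.m∸n≤m n k) q)))
  (≡.sym (countBounded-suc ℓ′ k≤n)))

-- The test unfolds to comparisons of the residues modulo 4 and modulo 6, and 12 is their least
-- common multiple.
admissible-periodic : ∀ m i → does (admissible? (m ℕ.+ i ℕ.* 12)) ≡ does (admissible? m)
admissible-periodic m i = ≡.cong₂ (λ r s → does (r ℕ.≟ 0) ∨ (does (s ℕ.≟ 1) ∨ does (s ℕ.≟ 5)))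
  (≡.trans (≡.cong (λ t → (m ℕ.+ t) % 4) (≡.sym (ℕ.*-assoc i 3 4))) ([m+kn]%n≡m%n m (i ℕ.* 3) 4))
  (≡.trans (≡.cong (λ t → (m ℕ.+ t) % 6) (≡.sym (ℕ.*-assoc i 2 6))) ([m+kn]%n≡m%n m (i ℕ.* 2) 6))

module DpSeries where
  private
    R : CommutativeRing _ _
    R = moduloRing 2
    module K = CommutativeRing R

    is3Ring : Is3Ring R
    is3Ring = record { 1+1+1≈0 = ≡.refl ; x³≈x = cube-modulo-3 }

  open PowerSeries R
  open Theta R
  open CharacteristicThree R is3Ring
  open SemiringSolver commutativeSemiring using (solve; _:=_; _:+_; _:*_; con)
  open SetoidReasoning setoid

  dpSeries : Series
  dpSeries = dp

  -- The length bound is set to the total, where it is vacuous, so only the bound `k` on the parts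
  -- remains.
  boundedSeries : ℕ → Series
  boundedSeries k n = countBounded n k n

  factor : ℕ → Series
  factor k = if does (admissible? (suc k)) then 1# + - (X ^ suc k) else 1#

  boundedSeries-small : ∀ k {n} → n ℕ.≤ k → boundedSeries (suc k) n ≡ boundedSeries k n
  boundedSeries-small k {zero}  _   = ≡.trans (countBounded-zero 0 (suc k)) (≡.sym (countBounded-zero 0 k))
  boundedSeries-small k {suc n} n<k = countBounded-small n n<k

  -- Either the part k + 1 is absent, or one copy is removed. Further copies may remain, hence the
  -- same series on the right, which makes the relation a geometric series in disguise.
  boundedSeries-suc : ∀ k → boundedSeries (suc k) ≈
    boundedSeries k + (if does (admissible? (suc k)) then X ^ suc k * boundedSeries (suc k) else 0#)
  boundedSeries-suc k = coeffwise at
    where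
    term : Bool → Series
    term b = if b then X ^ suc k * boundedSeries (suc k) else 0#
    term-small : ∀ b {n} → n ℕ.≤ k → term b n K.≈ 0
    term-small false _   = ≡.refl
    term-small true  n≤k = coeff[] (zero[]-* (boundedSeries (suc k)) (noConstant-^ noConstant-X (suc k))) (s≤s n≤k)
    term-large : ∀ b d → term b (suc (k ℕ.+ d)) K.≈ (if b then boundedSeries (suc k) d else 0)
    term-large false d = ≡.refl
    term-large true  d = X^-* (suc k) (boundedSeries (suc k)) d
    at : ∀ n → boundedSeries (suc k) n K.≈ boundedSeries k n ℕ.+ term (does (admissible? (suc k))) n
    at n with ℕ.≤-<-connex n k
    ... | inj₁ n≤k = ≡.trans (≡.cong (_% 3) (boundedSeries-small k n≤k))
      (≡.sym (≡.trans (K.+-congˡ {boundedSeries k n} (term-small (does (admissible? (suc k))) n≤k))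
        (K.+-identityʳ (boundedSeries k n))))
    at (suc n) | inj₂ (s≤s k≤n) = ≡.trans
      (≡.cong (_% 3) (≡.trans (countBounded-suc n k≤n)
        (≡.cong (λ x → boundedSeries k (suc n) ℕ.+ (if does (admissible? (suc k)) then x else 0))
          (countBounded-stable n (n ℕ.∸ k) (suc k) (ℕ.m∸n≤m n k) ℕ.≤-refl))))
      (K.+-congˡ {boundedSeries k (suc n)} (≡.sym (≡.subst
        (λ m → term (does (admissible? (suc k))) (suc m) K.≈ (if does (admissible? (suc k)) then boundedSeries (suc k) (n ℕ.∸ k) else 0))
        (ℕ.m+[n∸m]≡n k≤n) (term-large (does (admissible? (suc k))) (n ℕ.∸ k)))))

  boundedSeries-factor : ∀ k → boundedSeries (suc k) * factor k ≈ boundedSeries k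
  boundedSeries-factor k with does (admissible? (suc k)) | boundedSeries-suc k
  ... | false | p = trans (*-identityʳ _) (trans p (+-identityʳ _))
  ... | true  | p = begin
    f * (1# + - x)        ≈⟨ trans (distribˡ f 1# (- x)) (+-congʳ (*-identityʳ f)) ⟩
    f + f * - x           ≈⟨ +-cong p (trans (*-comm f (- x)) (sym (-‿distribˡ-* x f))) ⟩
    g + x * f + - (x * f) ≈⟨ +-assoc g (x * f) (- (x * f)) ⟩
    g + (x * f + - (x * f)) ≈⟨ trans (+-congˡ (-‿inverseʳ (x * f))) (+-identityʳ g) ⟩
    g                     ∎
    where
    f g x : Series
    f = boundedSeries (suc k)
    g = boundedSeries k
    x = X ^ suc k

  boundedSeries-product : ∀ k → boundedSeries k * Π.fold factor k ≈ 1#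
  boundedSeries-product zero    = trans (*-identityʳ _) (coeffwise λ { zero → ≡.refl ; (suc n) → ≡.refl })
  boundedSeries-product (suc k) = begin
    boundedSeries (suc k) * Π.fold factor (suc k)       ≈⟨ *-congˡ (Π.fold-snoc factor k) ⟩
    boundedSeries (suc k) * (Π.fold factor k * factor k)
      ≈⟨ solve 3 (λ f p x → f :* (p :* x) := f :* x :* p) refl (boundedSeries (suc k)) (Π.fold factor k) (factor k) ⟩
    boundedSeries (suc k) * factor k * Π.fold factor k  ≈⟨ *-congʳ (boundedSeries-factor k) ⟩
    boundedSeries k * Π.fold factor k                   ≈⟨ boundedSeries-product k ⟩
    1#                                                  ∎

  boundedSeries-limit : ∀ N → dpSeries ≈[ N ] boundedSeries N
  boundedSeries-limit N = coeffwise[] λ {n} n<N → ≡.cong (_% 3) (≡.trans (≡.sym (stable (N ℕ.∸ n) n))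
    (≡.cong (λ k → boundedSeries k n) (ℕ.m∸n+n≡m (ℕ.<⇒≤ n<N))))
    where
    stable : ∀ d n → boundedSeries (d ℕ.+ n) n ≡ boundedSeries n n
    stable zero    n = ≡.refl
    stable (suc d) n = ≡.trans (boundedSeries-small (d ℕ.+ n) (ℕ.m≤n+m n d)) (stable d n)

  factor-convergent : Π.Convergent factor
  factor-convergent k with does (admissible? (suc k))
  ... | false = refl[]
  ... | true  = 1+-zero[] (trans[] (≈⇒≈[] (-‿distribˡ-* X (X ^ k)))
    (*-zero[] (- X) (noConstant-^ noConstant-X k)))

  dpSeries-product : dpSeries * Π.fold∞ factor ≈ 1#
  dpSeries-product = ≈[]⇒≈ λ N → trans[]
    (*-cong[] (boundedSeries-limit N) (Π.fold∞-truncate factor-convergent ℕ.≤-refl))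
    (≈⇒≈[] (boundedSeries-product N))

  -- Used with k (n + 1) = 12, which puts the products with steps 6, 6 and 4 on the common period of
  -- `factor`.
  poch-blocks : ∀ k .{{_ : ℕ.NonZero k}} m n → poch (- (X ^ m)) (X ^ suc n) ≈
    Π.fold∞ (λ i → Π.fold (λ j → 1# + - (X ^ (m ℕ.+ suc n ℕ.* j) * (X ^ (suc n ℕ.* k)) ^ i)) k)
  poch-blocks k m n = trans (poch-split k (- (X ^ m)) (noConstant-^suc n noConstant-X))
    (Π.fold∞-cong λ i → Π.fold-cong (λ j → +-congˡ {x = 1#} (begin
      - (X ^ m) * (X ^ suc n) ^ j * ((X ^ suc n) ^ k) ^ i
        ≈⟨ *-cong (sym (-‿distribˡ-* (X ^ m) ((X ^ suc n) ^ j))) (^-congˡ i (^-assocʳ X (suc n) k)) ⟩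
      - (X ^ m * (X ^ suc n) ^ j) * (X ^ (suc n ℕ.* k)) ^ i
        ≈⟨ -‿distribˡ-* _ _ ⟨
      - (X ^ m * (X ^ suc n) ^ j * (X ^ (suc n ℕ.* k)) ^ i)
        ≈⟨ -‿cong (*-congʳ (trans (*-congˡ (^-assocʳ X (suc n) j)) (sym (^-homo-* X m (suc n ℕ.* j))))) ⟩
      - (X ^ (m ℕ.+ suc n ℕ.* j) * (X ^ (suc n ℕ.* k)) ^ i) ∎)) k)

  factor-periodic : ∀ j i → factor (j ℕ.+ i ℕ.* 12) ≈
    (if does (admissible? (suc j)) then 1# + - (X ^ suc j * (X ^ 12) ^ i) else 1#)
  factor-periodic j i = trans (reflexive (≡.cong (λ b → if b then 1# + - (X ^ suc (j ℕ.+ i ℕ.* 12)) else 1#)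
      (admissible-periodic (suc j) i)))
    (branch (does (admissible? (suc j))))
    where
    branch : ∀ b → (if b then 1# + - (X ^ suc (j ℕ.+ i ℕ.* 12)) else 1#) ≈
                   (if b then 1# + - (X ^ suc j * (X ^ 12) ^ i) else 1#)
    branch false = refl
    branch true  = +-congˡ {x = 1#} (-‿cong (trans (^-homo-* X (suc j) (i ℕ.* 12))
      (*-congˡ (trans (^-congʳ X (ℕ.*-comm i 12)) (sym (^-assocʳ X 12 i))))))

  block-convergent : ∀ k m n →
    Π.Convergent (λ i → Π.fold (λ j → 1# + - (X ^ (m ℕ.+ n ℕ.* j) * (X ^ 12) ^ i)) k)
  block-convergent k m n i = Π.fold-one[] (λ j → 1+-zero[] (trans[]
    (≈⇒≈[] (-‿distribˡ-* (X ^ (m ℕ.+ n ℕ.* j)) ((X ^ 12) ^ i)))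
    (*-zero[] (- (X ^ (m ℕ.+ n ℕ.* j))) (noConstant-^ (noConstant-^suc 11 noConstant-X) i)))) k

  factor-product : Π.fold∞ factor ≈
    poch (- X) (X ^ 6) * poch (- (X ^ 5)) (X ^ 6) * poch (- (X ^ 4)) (X ^ 4)
  factor-product = begin
    Π.fold∞ factor
      ≈⟨ Π.fold∞-blocks 12 factor-convergent ⟩
    Π.fold∞ (λ i → Π.fold (λ j → factor (j ℕ.+ i ℕ.* 12)) 12)
      ≈⟨ Π.fold∞-cong (λ i → trans (Π.fold-cong (λ j → factor-periodic j i) 12) (reorder i)) ⟩
    Π.fold∞ (λ i → block 2 1 6 i * block 2 5 6 i * block 3 4 4 i)
      ≈⟨ Π.fold∞-∙ (λ i → *-one[] (block-convergent 2 1 6 i) (block-convergent 2 5 6 i)) (block-convergent 3 4 4) ⟩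
    Π.fold∞ (λ i → block 2 1 6 i * block 2 5 6 i) * Π.fold∞ (block 3 4 4)
      ≈⟨ *-congʳ (Π.fold∞-∙ (block-convergent 2 1 6) (block-convergent 2 5 6)) ⟩
    Π.fold∞ (block 2 1 6) * Π.fold∞ (block 2 5 6) * Π.fold∞ (block 3 4 4)
      ≈⟨ *-cong (*-cong (poch-blocks 2 1 5) (poch-blocks 2 5 5)) (poch-blocks 3 4 3) ⟨
    poch (- (X ^ 1)) (X ^ 6) * poch (- (X ^ 5)) (X ^ 6) * poch (- (X ^ 4)) (X ^ 4)
      ≈⟨ *-congʳ (*-congʳ (poch-cong (-‿cong (*-identityʳ X)) refl)) ⟩
    poch (- X) (X ^ 6) * poch (- (X ^ 5)) (X ^ 6) * poch (- (X ^ 4)) (X ^ 4) ∎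
    where
    block : ℕ → ℕ → ℕ → ℕ → Series
    block k m n i = Π.fold (λ j → 1# + - (X ^ (m ℕ.+ n ℕ.* j) * (X ^ 12) ^ i)) k
    reorder : ∀ i → Π.fold (λ j → if does (admissible? (suc j)) then 1# + - (X ^ suc j * (X ^ 12) ^ i) else 1#) 12
                  ≈ block 2 1 6 i * block 2 5 6 i * block 3 4 4 i
    -- The admissible sizes in one period are 1, 4, 5, 7, 8, 11, 12, each counted once since
    -- multiples of 4 are even and the rest odd. They regroup as 1, 7 and 5, 11 and 4, 8, 12.
    reorder i = solve 7 (λ t₁ t₄ t₅ t₇ t₈ t₁₁ t₁₂ →
        t₁ :* (con 1 :* (con 1 :* (t₄ :* (t₅ :* (con 1 :* (t₇ :* (t₈ :* (con 1 :* (con 1 :* (t₁₁ :* (t₁₂ :* con 1)))))))))))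
        := t₁ :* (t₇ :* con 1) :* (t₅ :* (t₁₁ :* con 1)) :* (t₄ :* (t₈ :* (t₁₂ :* con 1))))
      refl (t 1) (t 4) (t 5) (t 7) (t 8) (t 11) (t 12)
      where
      t : ℕ → Series
      t m = 1# + - (X ^ m * (X ^ 12) ^ i)

  dpSeries-theta : dpSeries * (poch (- X) (X ^ 6) * poch (- (X ^ 5)) (X ^ 6) * poch (- (X ^ 4)) (X ^ 4)) ≈ 1#
  dpSeries-theta = trans (*-congˡ (sym factor-product)) dpSeries-product

  -- Sections compose contravariantly: the outermost one acts on n first, so the index is left in
  -- the nested form in which it arises.
  dp-27n+16 : ∀ n → dp (((n ℕ.* 3 ℕ.+ 1) ℕ.* 3 ℕ.+ 2) ℕ.* 3 ℕ.+ 1) % 3 ≡ 0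
  dp-27n+16 = coeff (section₁₂₁-vanishes {dpSeries} dpSeries-theta)

  dp-27n+7 : ∀ n → dp (((n ℕ.* 3 ℕ.+ 0) ℕ.* 3 ℕ.+ 2) ℕ.* 3 ℕ.+ 1) % 3 ≡ dp (n ℕ.* 3 ℕ.+ 1) % 3
  dp-27n+7 = coeff (section₀₂₁-periodic {dpSeries} dpSeries-theta)

open import Data.Nat.Base using (_+_; _*_; _^_; _/_; _∸_; _≥_)

-- Induction along the progressions

private
  -- With α = a + 1, the number s for which (7·9^α + 1)/4 = 3s + 1. It starts from 16 = 3·5 + 1, and
  -- its recursion is 9(3s + 1) - 2 = 3(9s + 2) + 1.
  offset : ℕ → ℕ
  offset zero    = 5
  offset (suc a) = 2 + 9 * offset a

  offset-spec : ∀ a → 7 * 9 ^ suc a + 1 ≡ (offset a * 3 + 1) * 4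
  offset-spec zero    = ≡.refl
  offset-spec (suc a) = ≡.trans (identity₁ (9 ^ suc a)) (≡.trans
    -- Four times the step from x to 9x - 2. Truncated subtraction is exact here, as both minuends
    -- are exhibited as 8 plus the result.
    (≡.cong (λ x → 9 * x ∸ 8) (offset-spec a)) (≡.trans (≡.cong (_∸ 8) (identity₂ (offset a))) (ℕ.m+n∸m≡n 8 _)))
    where
    identity₁ : ∀ p → 7 * (9 * p) + 1 ≡ 9 * (7 * p + 1) ∸ 8
    identity₁ p = ≡.sym (≡.trans (≡.cong (_∸ 8) (shift p)) (ℕ.m+n∸m≡n 8 _))
      where
      shift : ∀ p → 9 * (7 * p + 1) ≡ 8 + (7 * (9 * p) + 1)
      shift = solve-∀
    identity₂ : ∀ s → 9 * ((s * 3 + 1) * 4) ≡ 8 + ((2 + 9 * s) * 3 + 1) * 4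
    identity₂ = solve-∀

  -- For a + 1 the index is 27m + 7 with m = 9^(a+1) n + `offset a`; `dp-27n+7` leads back to 3m +
  -- 1, the index for `a` with the same n.
  dp-vanishes : ∀ a n → dp ((9 ^ suc a * n + offset a) * 3 + 1) % 3 ≡ 0
  dp-vanishes zero n = ≡.trans (≡.cong (λ m → dp m % 3) (index n)) (DpSeries.dp-27n+16 n)
    where
    index : ∀ n → (9 * 1 * n + 5) * 3 + 1 ≡ ((n * 3 + 1) * 3 + 2) * 3 + 1
    index = solve-∀
  dp-vanishes (suc a) n = ≡.trans (≡.cong (λ m → dp m % 3) (index (9 ^ suc a) n (offset a)))
    (≡.trans (DpSeries.dp-27n+7 (9 ^ suc a * n + offset a)) (dp-vanishes a n))
    where
    index : ∀ p n s → (9 * p * n + (2 + 9 * s)) * 3 + 1 ≡ (((p * n + s) * 3 + 0) * 3 + 2) * 3 + 1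
    index = solve-∀

theorem1p6 : (α n : ℕ) → α ≥ 1 →
    3 ∣ dp (3 ^ (2 * α + 1) * n + (7 * 9 ^ α + 1) / 4)
theorem1p6 (suc a) n _ = m%n≡0⇒n∣m _ 3 (≡.trans (≡.cong (λ m → dp m % 3) index) (dp-vanishes a n))
  where
  power : 3 ^ (2 * suc a + 1) ≡ 9 ^ suc a * 3
  power = ≡.trans (ℕ.^-distribˡ-+-* 3 (2 * suc a) 1) (≡.cong (_* 3) (≡.sym (ℕ.^-*-assoc 3 2 (suc a))))
  regroup : ∀ p s → p * 3 * n + (s * 3 + 1) ≡ (p * n + s) * 3 + 1
  regroup p s = identity p s n
    where
    identity : ∀ p s n → p * 3 * n + (s * 3 + 1) ≡ (p * n + s) * 3 + 1
    identity = solve-∀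
  index : 3 ^ (2 * suc a + 1) * n + (7 * 9 ^ suc a + 1) / 4 ≡ (9 ^ suc a * n + offset a) * 3 + 1
  index = ≡.trans (≡.cong₂ (λ p s → p * n + s) power
      (≡.trans (≡.cong (_/ 4) (offset-spec a)) (m*n/n≡m (offset a * 3 + 1) 4)))
    (regroup (9 ^ suc a) (offset a))
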